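{- Let $(W,S)$ be a Coxeter group with Coxeter matrix $(m_{s,s'})$, let $w\in W$, let $(s,t)\in\mathfrak{M}$, and let $\vec a,\vec b$ be reduced expressions for $w$ such that $\vec b$ is obtained from $\vec a$ by an $(s,t)$-braid move. Let $q\in W$ be such that $\operatorname{Invs}\vec b$ is obtained from $\operatorname{Invs}\vec a$ by replacing a particular factor of the form $q\rho_{s,t}q^{ -1}$ by its reversal (such $q$ exists). Set $s'=qsq^{ -1}$ and $t'=qtq^{ -1}$ (so $(s',t'),(t',s')\in\mathfrak{N}$). Then $$\operatorname{Has}\vec b=\operatorname{Has}\vec a-(s',t')+(t',s')\quad\text{in }\mathbb{Z}[\mathfrak{N}].$$
   Context: $(W,S)$ is a Coxeter group (generators $S$, relations $(st)^{m_{s,t}}=1$ for $m_{s,t}<\infty$, $m_{s,s}=1$, $m_{s,t}=m_{t,s}\ge2$ for $s\ne t$). $T=\bigcup_{x\in W}xSx^{ -1}$. For distinct $u,v\in T$, $m_{u,v}$ is the order of $uv$ and, if finite, $\rho_{u,v}=((uv)^0u,(uv)^1u,\ldots,(uv)^{m_{u,v}-1}u)$; $q\rho q^{ -1}$ means conjugating each entry by $q$. $\mathfrak{M}=\{(s,t)\in S\times S: s\ne t,\ m_{s,t}<\infty\}$ and $\mathfrak{N}=\bigcup_{x\in W}x\mathfrak{M}x^{ -1}\subseteq T\times T$ (conjugating both entries). Reduced expression: tuple $(a_1,\ldots,a_k)\in S^k$ with $w=a_1\cdots a_k$, $k$ minimal. An $(s,t)$-braid move replaces a contiguous factor $(s,t,s,\ldots)$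 of length $m_{s,t}$ by $(t,s,t,\ldots)$ of length $m_{s,t}$. $\operatorname{Invs}(a_1,\ldots,a_k)=(t_1,\ldots,t_k)$, $t_i=(a_1\cdots a_{i-1})a_i(a_1\cdots a_{i-1})^{ -1}$. For $(u,v)\in\mathfrak{N}$ and a reduced expression $\vec a$, $\operatorname{has}_{u,v}\vec a=1$ if $\rho_{u,v}$ appears as a (not necessarily contiguous) subword of $\operatorname{Invs}\vec a$, and $0$ otherwise. $\mathbb{Z}[\mathfrak{N}]$ is the free $\mathbb{Z}$-module with basis $\mathfrak{N}$ and $\operatorname{Has}\vec a=\sum_{(u,v)\in\mathfrak{N}}\operatorname{has}_{u,v}\vec a\cdot(u,v)$. -}

module Defs where

open import Level using (_⊔_)
open import Algebra.Bundles using (Group)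
import Algebra.Properties.Group as GroupProperties
open import Axiom.ExcludedMiddle using (ExcludedMiddle)
open import Data.Empty using (⊥-elim)
open import Data.Fin.Base using (Fin; toℕ)
open import Data.Integer.Base as ℤ using (ℤ; 0ℤ; 1ℤ)
import Data.Integer.Properties as ℤₚ
open import Data.List.Base using (List; []; _∷_; [_]; _++_; map; foldr; length; take; lookup; tabulate; applyUpTo; reverse; concat; cartesianProductWith)
import Data.List.Membership.Setoid as Membership
import Data.List.Membership.Setoid.Properties as Membershipₚ
import Data.List.Relation.Binary.Equality.Setoid as ListEquality
import Data.List.Relation.Binary.Sublist.Setoid as Sublist
open import Data.List.Relation.Binary.Pointwise.Base using ([]; _∷_)
open import Data.List.Relation.Unary.Any using (here)
import Data.List.Relation.Unary.Any.Properties as Anyₚ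
open import Data.Nat.Base using (ℕ; zero; suc; _≤_; _<_; z≤n; s≤s)
open import Data.Nat.Induction using (Acc; acc; <-wellFounded)
open import Data.Nat.Properties using (≤-antisym; ≤-trans; ≮⇒≥; n<1+n)
open import Data.Product.Base using (∃; ∃₂; _×_; _,_; proj₁; proj₂)
open import Function.Base using (_∘_)
open import Relation.Binary.Bundles using (Setoid; DecSetoid)
import Relation.Binary.Construct.Add.Supremum.NonStrict as AddSupremum
open import Relation.Binary.PropositionalEquality as ≡ using (_≡_; _≢_)
import Relation.Binary.Reasoning.Setoid as SetoidReasoning
open import Relation.Nullary using (¬_; yes; no)
open import Relation.Nullary.Construct.Add.Supremum using (_⁺) renaming ([_] to fin)

------------------------------------------------------------------------
-- The free ℤ-module on a set: finitely supported functions to ℤ.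

module FreeModule {c ℓ} (X : DecSetoid c ℓ) where
  open DecSetoid X using (_≟_; setoid) renaming (Carrier to A; _≈_ to _≈ˣ_; sym to ≈ˣ-sym; trans to ≈ˣ-trans)
  open Membership setoid using (_∈_)

  record FinSupp : Set (c ⊔ ℓ) where
    field
      coeff         : A → ℤ
      coeff-cong    : ∀ {x y} → x ≈ˣ y → coeff x ≡ coeff y
      finiteSupport : ∃ λ xs → ∀ x → coeff x ≢ 0ℤ → x ∈ xs

  open FinSupp public

  infix  4 _≐_
  infixl 6 _⊕_ _⊖_

  _≐_ : FinSupp → FinSupp → Set c
  f ≐ g = ∀ x → coeff f x ≡ coeff g x

  basis : A → FinSupp
  basis a = record
    { coeff         = δ
    ; coeff-cong    = δ-cong
    ; finiteSupport = [ a ] , δ-support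
    }
    where
    δ : A → ℤ
    δ x with x ≟ a
    ... | yes _ = 1ℤ
    ... | no  _ = 0ℤ

    δ-cong : ∀ {x y} → x ≈ˣ y → δ x ≡ δ y
    δ-cong {x} {y} x≈y with x ≟ a | y ≟ a
    ... | yes _   | yes _   = ≡.refl
    ... | no  _   | no  _   = ≡.refl
    ... | yes x≈a | no  y≉a = ⊥-elim (y≉a (≈ˣ-trans (≈ˣ-sym x≈y) x≈a))
    ... | no  x≉a | yes y≈a = ⊥-elim (x≉a (≈ˣ-trans x≈y y≈a))

    δ-support : ∀ x → δ x ≢ 0ℤ → x ∈ [ a ]
    δ-support x δ≢0 with x ≟ a
    ... | yes x≈a = here x≈a
    ... | no  _   = ⊥-elim (δ≢0 ≡.refl)

  _⊕_ : FinSupp → FinSupp → FinSupp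
  f ⊕ g = record
    { coeff         = λ x → coeff f x ℤ.+ coeff g x
    ; coeff-cong    = λ x≈y → ≡.cong₂ ℤ._+_ (coeff-cong f x≈y) (coeff-cong g x≈y)
    ; finiteSupport = proj₁ (finiteSupport f) ++ proj₁ (finiteSupport g) , support
    }
    where
    support : ∀ x → coeff f x ℤ.+ coeff g x ≢ 0ℤ → x ∈ proj₁ (finiteSupport f) ++ proj₁ (finiteSupport g)
    support x sum≢0 with coeff f x ℤₚ.≟ 0ℤ | coeff g x ℤₚ.≟ 0ℤ
    ... | no  f≢0 | _       = Membershipₚ.∈-++⁺ˡ setoid (proj₂ (finiteSupport f) x f≢0)
    ... | yes _   | no  g≢0 = Membershipₚ.∈-++⁺ʳ setoid (proj₁ (finiteSupport f)) (proj₂ (finiteSupport g) x g≢0)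
    ... | yes f≡0 | yes g≡0 = ⊥-elim (sum≢0 (≡.cong₂ ℤ._+_ f≡0 g≡0))

  ⊝_ : FinSupp → FinSupp
  ⊝ f = record
    { coeff         = λ x → ℤ.- coeff f x
    ; coeff-cong    = λ x≈y → ≡.cong (λ z → ℤ.- z) (coeff-cong f x≈y)
    ; finiteSupport = proj₁ (finiteSupport f) , λ x -f≢0 → proj₂ (finiteSupport f) x (-f≢0 ∘ ≡.cong (λ z → ℤ.- z))
    }

  _⊖_ : FinSupp → FinSupp → FinSupp
  f ⊖ g = f ⊕ (⊝ g)

------------------------------------------------------------------------
-- Coxeter matrices. An element of ℕ ⁺ is either fin n or ∞.

open AddSupremum _≤_ using (_≤⁺_)

record CoxeterMatrix {ℓ} (S : Set ℓ) : Set ℓ where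
  field
    m          : S → S → ℕ ⁺
    m-diagonal : ∀ s → m s s ≡ fin 1
    m-sym      : ∀ s t → m s t ≡ m t s
    m-off      : ∀ {s t} → s ≢ t → fin 2 ≤⁺ m s t

module CoxeterGroup {ℓ} {S : Set ℓ} (M : CoxeterMatrix S) where
  open CoxeterMatrix M

  -- W is the group with generators S and relations (s t)^{m s t} = 1
  -- whenever m s t is finite: group terms in the generators, modulo the
  -- least congruence _≈_ that contains the group axioms and the relations.

  infix  4 _≈_
  infixl 7 _∙_
  infix  8 _⁻¹
  infixr 8 _^_

  data W : Set ℓ where
    gen : S → W
    ε   : W
    _∙_ : W → W → W
    _⁻¹ : W → W

  _^_ : W → ℕ → W
  g ^ zero  = ε
  g ^ suc n = g ∙ g ^ n

  data _≈_ : W → W → Set ℓ where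
    relation  : ∀ s t {n} → m s t ≡ fin n → (gen s ∙ gen t) ^ n ≈ ε
    ≈-refl    : ∀ {g} → g ≈ g
    ≈-sym     : ∀ {g h} → g ≈ h → h ≈ g
    ≈-trans   : ∀ {g h k} → g ≈ h → h ≈ k → g ≈ k
    ∙-cong    : ∀ {g g′ h h′} → g ≈ g′ → h ≈ h′ → g ∙ h ≈ g′ ∙ h′
    ⁻¹-cong   : ∀ {g g′} → g ≈ g′ → g ⁻¹ ≈ g′ ⁻¹
    assoc     : ∀ g h k → (g ∙ h) ∙ k ≈ g ∙ (h ∙ k)
    identityˡ : ∀ g → ε ∙ g ≈ g
    identityʳ : ∀ g → g ∙ ε ≈ g
    inverseˡ  : ∀ g → g ⁻¹ ∙ g ≈ ε
    inverseʳ  : ∀ g → g ∙ g ⁻¹ ≈ ε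

  group : Group ℓ ℓ
  group = record
    { Carrier = W
    ; _≈_     = _≈_
    ; _∙_     = _∙_
    ; ε       = ε
    ; _⁻¹     = _⁻¹
    ; isGroup = record
      { isMonoid = record
        { isSemigroup = record
          { isMagma = record
            { isEquivalence = record { refl = ≈-refl ; sym = ≈-sym ; trans = ≈-trans }
            ; ∙-cong        = ∙-cong
            }
          ; assoc   = assoc
          }
        ; identity    = identityˡ , identityʳ
        }
      ; inverse  = inverseˡ , inverseʳ
      ; ⁻¹-cong  = ⁻¹-cong
      }
    }

  open Group group public using () renaming (setoid to W-setoid)
  open ListEquality W-setoid public using (_≋_)
  open Sublist W-setoid public using (_⊆_)
  open Membership W-setoid using (_∈_)

  conj : W → W → W
  conj x g = x ∙ g ∙ x ⁻¹

  record IsOrder (g : W) (n : ℕ) : Set ℓ where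
    field
      positive : 0 < n
      power    : g ^ n ≈ ε
      minimal  : ∀ {k} → 0 < k → g ^ k ≈ ε → n ≤ k

  Expression : Set ℓ
  Expression = List S

  product : Expression → W
  product = foldr (λ s g → gen s ∙ g) ε

  record IsReducedExpressionFor (w : W) (a : Expression) : Set ℓ where
    field
      represents : product a ≈ w
      shortest   : ∀ c → product c ≈ w → length a ≤ length c

  Invs : Expression → List W
  Invs a = tabulate λ (i : Fin (length a)) →
    conj (product (take (toℕ i) a)) (gen (lookup a i))

  record 𝔐 : Set ℓ where
    field
      s t    : S
      s≢t    : s ≢ t
      mₛₜ    : ℕ
      finite : m s t ≡ fin mₛₜ

  swap : 𝔐 → 𝔐
  swap μ = record
    { s      = t
    ; t      = s
    ; s≢t    = s≢t ∘ ≡.sym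
    ; mₛₜ    = mₛₜ
    ; finite = ≡.trans (m-sym t s) finite
    }
    where open 𝔐 μ

  -- The word s t s ⋯ of length n.
  alternating : S → S → ℕ → Expression
  alternating s t zero    = []
  alternating s t (suc n) = s ∷ alternating t s n

  BraidMove : 𝔐 → Expression → Expression → Set ℓ
  BraidMove μ a b = ∃₂ λ p r →
    a ≡ p ++ alternating s t mₛₜ ++ r ×
    b ≡ p ++ alternating t s mₛₜ ++ r
    where open 𝔐 μ

  record 𝔑 : Set ℓ where
    field
      u v       : W
      conjugate : ∃₂ λ x μ → u ≈ conj x (gen (𝔐.s μ)) × v ≈ conj x (gen (𝔐.t μ))

  infix 4 _≈ᴺ_
  _≈ᴺ_ : 𝔑 → 𝔑 → Set ℓ
  n ≈ᴺ n′ = 𝔑.u n ≈ 𝔑.u n′ × 𝔑.v n ≈ 𝔑.v n′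

  -- (s , t) regarded as an element of 𝔑.
  ι : 𝔐 → 𝔑
  ι μ = record
    { u         = gen s
    ; v         = gen t
    ; conjugate = ε , μ , ε-conj (gen s) , ε-conj (gen t)
    }
    where
    open 𝔐 μ
    ε-conj : ∀ g → g ≈ conj ε g
    ε-conj g = ≈-sym (≈-trans (∙-cong (identityˡ g) (GroupProperties.ε⁻¹≈ε group)) (identityʳ g))

  -- (q s q⁻¹ , q t q⁻¹).
  conj𝔐 : W → 𝔐 → 𝔑
  conj𝔐 q μ = record
    { u         = conj q (gen (𝔐.s μ))
    ; v         = conj q (gen (𝔐.t μ))
    ; conjugate = q , μ , ≈-refl , ≈-refl
    }

  open SetoidReasoning W-setoid

  conj-cancel : ∀ x g → x ⁻¹ ∙ (x ∙ g) ≈ g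
  conj-cancel x g = ≈-trans (≈-sym (assoc _ _ _)) (≈-trans (∙-cong (inverseˡ x) ≈-refl) (identityˡ g))

  conj-∙ : ∀ x g h → conj x g ∙ conj x h ≈ conj x (g ∙ h)
  conj-∙ x g h = begin
    x ∙ g ∙ x ⁻¹ ∙ (x ∙ h ∙ x ⁻¹)     ≈⟨ assoc _ _ _ ⟩
    x ∙ g ∙ (x ⁻¹ ∙ (x ∙ h ∙ x ⁻¹))   ≈⟨ ∙-cong ≈-refl (∙-cong ≈-refl (assoc _ _ _)) ⟩
    x ∙ g ∙ (x ⁻¹ ∙ (x ∙ (h ∙ x ⁻¹))) ≈⟨ ∙-cong ≈-refl (conj-cancel x _) ⟩
    x ∙ g ∙ (h ∙ x ⁻¹)                ≈⟨ assoc _ _ _ ⟨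
    x ∙ g ∙ h ∙ x ⁻¹                  ≈⟨ ∙-cong (assoc _ _ _) ≈-refl ⟩
    x ∙ (g ∙ h) ∙ x ⁻¹                ∎

  conj-ε : ∀ x → conj x ε ≈ ε
  conj-ε x = ≈-trans (∙-cong (identityʳ x) ≈-refl) (inverseʳ x)

  conj-cong : ∀ x {g h} → g ≈ h → conj x g ≈ conj x h
  conj-cong x g≈h = ∙-cong (∙-cong ≈-refl g≈h) ≈-refl

  conj-^ : ∀ x g n → conj x g ^ n ≈ conj x (g ^ n)
  conj-^ x g zero    = ≈-sym (conj-ε x)
  conj-^ x g (suc n) = ≈-trans (∙-cong ≈-refl (conj-^ x g n)) (conj-∙ x g (g ^ n))

  ^-cong : ∀ {g h} n → g ≈ h → g ^ n ≈ h ^ n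
  ^-cong zero    g≈h = ≈-refl
  ^-cong (suc n) g≈h = ∙-cong g≈h (^-cong n g≈h)

  positive-m : (μ : 𝔐) → 0 < 𝔐.mₛₜ μ
  positive-m μ with m (𝔐.s μ) (𝔐.t μ) | m-off (𝔐.s≢t μ) | 𝔐.finite μ
  ... | _ | AddSupremum.[ 2≤m ] | ≡.refl = ≤-trans (s≤s z≤n) 2≤m

  power-uv : (n : 𝔑) → ∃ λ k → 0 < k × (𝔑.u n ∙ 𝔑.v n) ^ k ≈ ε
  power-uv n with 𝔑.conjugate n
  ... | x , μ , u≈ , v≈ = mₛₜ , positive-m μ , (begin
    (𝔑.u n ∙ 𝔑.v n) ^ mₛₜ                   ≈⟨ ^-cong mₛₜ (∙-cong u≈ v≈) ⟩
    (conj x (gen s) ∙ conj x (gen t)) ^ mₛₜ ≈⟨ ^-cong mₛₜ (conj-∙ x _ _) ⟩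
    conj x (gen s ∙ gen t) ^ mₛₜ            ≈⟨ conj-^ x _ mₛₜ ⟩
    conj x ((gen s ∙ gen t) ^ mₛₜ)          ≈⟨ conj-cong x (relation s t finite) ⟩
    conj x ε                                ≈⟨ conj-ε x ⟩
    ε                                       ∎)
    where open 𝔐 μ

  gen² : ∀ s → gen s ∙ gen s ≈ ε
  gen² s = ≈-trans (≈-sym (identityʳ _)) (relation s s (m-diagonal s))

  v² : (n : 𝔑) → 𝔑.v n ∙ 𝔑.v n ≈ ε
  v² n with 𝔑.conjugate n
  ... | x , μ , _ , v≈ = begin
    𝔑.v n ∙ 𝔑.v n                     ≈⟨ ∙-cong v≈ v≈ ⟩
    conj x (gen t) ∙ conj x (gen t)   ≈⟨ conj-∙ x _ _ ⟩
    conj x (gen t ∙ gen t)            ≈⟨ conj-cong x (gen² t) ⟩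
    conj x ε                          ≈⟨ conj-ε x ⟩
    ε                                 ∎
    where open 𝔐 μ

  IsOrder-unique : ∀ {g h k l} → g ≈ h → IsOrder g k → IsOrder h l → k ≡ l
  IsOrder-unique {k = k} {l} g≈h o o′ = ≤-antisym
    (IsOrder.minimal o (IsOrder.positive o′) (≈-trans (^-cong l g≈h) (IsOrder.power o′)))
    (IsOrder.minimal o′ (IsOrder.positive o) (≈-trans (^-cong k (≈-sym g≈h)) (IsOrder.power o)))

  applyUpTo-cong : ∀ {f g : ℕ → W} n → (∀ k → f k ≈ g k) → applyUpTo f n ≋ applyUpTo g n
  applyUpTo-cong zero    f≈g = []
  applyUpTo-cong (suc n) f≈g = f≈g 0 ∷ applyUpTo-cong n (f≈g ∘ suc)

  ⊆⇒∈ : ∀ {x xs ys} → xs ⊆ ys → x ∈ xs → x ∈ ys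
  ⊆⇒∈ = λ xs⊆ys → Sublist.lookup W-setoid (λ x≈y z≈x → ≈-trans z≈x x≈y) xs⊆ys

  -- Excluded middle is what lets has and the orders of elements be functions.

  module Classical (em : ExcludedMiddle ℓ) where

    find-order : ∀ g k → 0 < k → g ^ k ≈ ε → Acc _<_ k → ∃ (IsOrder g)
    find-order g k 0<k gᵏ≈ε (acc rec) with em {∃ λ j → j < k × 0 < j × g ^ j ≈ ε}
    ... | yes (j , j<k , 0<j , gʲ≈ε) = find-order g j 0<j gʲ≈ε (rec j<k)
    ... | no  ∄j = k , record
      { positive = 0<k
      ; power    = gᵏ≈ε
      ; minimal  = λ {l} 0<l gˡ≈ε → ≮⇒≥ (λ l<k → ∄j (l , l<k , 0<l , gˡ≈ε))
      }

    order-uv : (n : 𝔑) → ∃ (IsOrder (𝔑.u n ∙ 𝔑.v n))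
    order-uv n with power-uv n
    ... | k , 0<k , eq = find-order _ k 0<k eq (<-wellFounded k)

    mᴺ : 𝔑 → ℕ
    mᴺ n = proj₁ (order-uv n)

    ρ : 𝔑 → List W
    ρ n = applyUpTo (λ k → (u ∙ v) ^ k ∙ u) (mᴺ n)
      where open 𝔑 n

    ρ-cong : ∀ {n n′} → n ≈ᴺ n′ → ρ n ≋ ρ n′
    ρ-cong {n} {n′} (u≈ , v≈)
      rewrite IsOrder-unique (∙-cong u≈ v≈) (proj₂ (order-uv n)) (proj₂ (order-uv n′))
      = applyUpTo-cong (mᴺ n′) (λ k → ∙-cong (^-cong k (∙-cong u≈ v≈)) u≈)

    u∈ρ : ∀ n → 𝔑.u n ∈ ρ n
    u∈ρ n with order-uv n
    ... | zero  , o = ⊥-elim (case-0 (IsOrder.positive o))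
      where case-0 : ¬ 0 < 0
            case-0 ()
    ... | suc k , _ = here (≈-sym (identityˡ _))

    v∈ρ : ∀ n → 𝔑.v n ∈ ρ n
    v∈ρ n with order-uv n
    ... | zero  , o = ⊥-elim (case-0 (IsOrder.positive o))
      where case-0 : ¬ 0 < 0
            case-0 ()
    ... | suc k , o = Anyₚ.applyUpTo⁺ (λ j → (𝔑.u n ∙ 𝔑.v n) ^ j ∙ 𝔑.u n) last (n<1+n k)
      where
      open 𝔑 n
      open GroupProperties group
      last : v ≈ (u ∙ v) ^ k ∙ u
      last = begin
        v                        ≈⟨ inverseʳ-unique v v (v² n) ⟩
        v ⁻¹                     ≈⟨ identityʳ _ ⟨
        v ⁻¹ ∙ ε                 ≈⟨ ∙-cong ≈-refl (inverseˡ u) ⟨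
        v ⁻¹ ∙ (u ⁻¹ ∙ u)        ≈⟨ assoc _ _ _ ⟨
        v ⁻¹ ∙ u ⁻¹ ∙ u          ≈⟨ ∙-cong (⁻¹-anti-homo-∙ u v) ≈-refl ⟨
        (u ∙ v) ⁻¹ ∙ u           ≈⟨ ∙-cong (inverseʳ-unique (u ∙ v) _ (IsOrder.power o)) ≈-refl ⟨
        (u ∙ v) ^ k ∙ u          ∎

    𝔑-decSetoid : DecSetoid ℓ ℓ
    𝔑-decSetoid = record
      { Carrier          = 𝔑
      ; _≈_              = _≈ᴺ_
      ; isDecEquivalence = record
        { isEquivalence = record
          { refl  = ≈-refl , ≈-refl
          ; sym   = λ (p , q) → ≈-sym p , ≈-sym q
          ; trans = λ (p , q) (p′ , q′) → ≈-trans p p′ , ≈-trans q q′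
          }
        ; _≟_           = λ _ _ → em
        }
      }

    open FreeModule 𝔑-decSetoid public renaming (FinSupp to ℤ[𝔑])

    has : 𝔑 → Expression → ℤ
    has n a with em {ρ n ⊆ Invs a}
    ... | yes _ = 1ℤ
    ... | no  _ = 0ℤ

    has-cong : ∀ a {n n′} → n ≈ᴺ n′ → has n a ≡ has n′ a
    has-cong a {n} {n′} n≈n′@(u≈ , v≈) with em {ρ n ⊆ Invs a} | em {ρ n′ ⊆ Invs a}
    ... | yes _ | yes _ = ≡.refl
    ... | no  _ | no  _ = ≡.refl
    ... | yes p | no ¬p = ⊥-elim (¬p (⊆-trans (⊆-reflexive (ρ-cong {n′} {n} (≈-sym u≈ , ≈-sym v≈))) p))
      where open Sublist W-setoid using (⊆-trans; ⊆-reflexive)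
    ... | no ¬p | yes p = ⊥-elim (¬p (⊆-trans (⊆-reflexive (ρ-cong {n} {n′} n≈n′)) p))
      where open Sublist W-setoid using (⊆-trans; ⊆-reflexive)

    pair : W → W → List 𝔑
    pair u v with em {∃₂ λ x μ → u ≈ conj x (gen (𝔐.s μ)) × v ≈ conj x (gen (𝔐.t μ))}
    ... | yes c = [ record { u = u ; v = v ; conjugate = c } ]
    ... | no  _ = []

    open Membership (DecSetoid.setoid 𝔑-decSetoid) using () renaming (_∈_ to _∈ᴺ_)

    ∈-pair : ∀ n {u v} → 𝔑.u n ≈ u → 𝔑.v n ≈ v → n ∈ᴺ pair u v
    ∈-pair n {u} {v} u≈ v≈ with em {∃₂ λ x μ → u ≈ conj x (gen (𝔐.s μ)) × v ≈ conj x (gen (𝔐.t μ))}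
    ... | yes _ = here (u≈ , v≈)
    ... | no ¬c with 𝔑.conjugate n
    ...   | x , μ , p , q = ⊥-elim (¬c (x , μ , ≈-trans (≈-sym u≈) p , ≈-trans (≈-sym v≈) q))

    -- ρ_{u,v} contains u and v, so only pairs of entries of Invs a matter.
    candidates : Expression → List 𝔑
    candidates a = concat (cartesianProductWith pair (Invs a) (Invs a))

    has-support : ∀ a n → has n a ≢ 0ℤ → n ∈ᴺ candidates a
    has-support a n has≢0 with em {ρ n ⊆ Invs a}
    ... | no  _ = ⊥-elim (has≢0 ≡.refl)
    ... | yes p = Anyₚ.concat⁺ (Anyₚ.cartesianProductWith⁺ pair (∈-pair n) (⊆⇒∈ p (u∈ρ n)) (⊆⇒∈ p (v∈ρ n)))

    Has : Expression → ℤ[𝔑]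
    Has a = record
      { coeff         = λ n → has n a
      ; coeff-cong    = λ {n} {n′} → has-cong a {n} {n′}
      ; finiteSupport = candidates a , has-support a
      }

    -- Invs b arises from Invs a by reversing a factor q ρ_{s,t} q⁻¹.
    ReversesFactor : W → 𝔐 → Expression → Expression → Set ℓ
    ReversesFactor q μ a b = ∃₂ λ P R →
      Invs a ≋ P ++ map (conj q) (ρ (ι μ)) ++ R ×
      Invs b ≋ P ++ reverse (map (conj q) (ρ (ι μ))) ++ R

{-# OPTIONS --safe #-}
module Submission where

-- The braid move reverses a block D = q ρ_{s,t} q⁻¹ of Invs a, and the entries of Invs a are
-- pairwise distinct. If ρ_{u,v} is a subword of Invs a that meets D in at most one entry, the
-- reversal does not affect it. If it meets D in two entries, then, as D is contiguous, in two
-- adjacent entries of ρ_{u,v}; their product is u v, so u and v lie in the dihedral group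
-- q ⟨s,t⟩ q⁻¹. As (u , v) is conjugate to a pair in 𝔐, u v then has the same order as s t, so
-- ρ_{u,v} exhausts D and (u , v) = (s′ , t′).
--
-- For the equality of orders, let x conjugate a pair of simple reflections into ⟨s,t⟩. Replace x
-- by a shortest element of ⟨s,t⟩ x: by the parity cocycle η and the deletion property, the
-- conjugated pair is then {s , t}.

open import Defs
open import Algebra.Bundles using (Group)
import Algebra.Properties.Group as GroupProperties
import Algebra.Properties.Monoid as MonoidProperties
open import Axiom.ExcludedMiddle using (ExcludedMiddle)
open import Data.Bool.Base using (Bool; true; false; _xor_)
open import Data.Bool.Properties using (xor-assoc; xor-same; xor-identityʳ; ¬-not)
open import Data.Empty using (⊥-elim)
open import Data.Integer.Base as ℤ using (0ℤ; 1ℤ)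
import Data.Integer.Properties as ℤₚ
open import Data.List.Base using (List; []; _∷_; [_]; _++_; map; length; applyUpTo; applyDownFrom; reverse)
import Data.List.Membership.Setoid as Membership
import Data.List.Membership.Setoid.Properties as Membershipₚ
import Data.List.Properties as Listₚ
import Data.List.Relation.Binary.Equality.Setoid as ListEquality
open import Data.List.Relation.Binary.Pointwise.Base using ([]; _∷_)
import Data.List.Relation.Binary.Sublist.Setoid as Sublist
import Data.List.Relation.Binary.Sublist.Setoid.Properties as Sublistₚ
import Data.List.Relation.Unary.All.Properties as Allₚ
open import Data.List.Relation.Unary.AllPairs using ([]; _∷_)
open import Data.List.Relation.Unary.Any using (here; there)
import Data.List.Relation.Unary.Unique.Setoid as UniqueSetoid
import Data.List.Relation.Unary.Unique.Setoid.Properties as Uniqueₚ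
open import Data.Nat.Base using (ℕ; zero; suc; _+_; _*_; _∸_; _≤_; _<_; z≤n; s≤s; >-nonZero)
open import Data.Nat.DivMod using (_/_; _%_; m≡m%n+[m/n]*n; m%n<n)
open import Data.Nat.Induction using (Acc; acc; <-wellFounded)
import Data.Nat.Properties as ℕₚ
open import Data.Product.Base using (∃; ∃₂; _×_; _,_; proj₁; proj₂)
open import Data.Sum.Base as Sum using (_⊎_; inj₁; inj₂)
open import Function.Base using (_∘_)
open import Function.Bundles using (mk⇔)
open import Relation.Binary.Bundles using (Setoid; DecSetoid)
import Relation.Binary.Construct.Add.Supremum.NonStrict as AddSupremum
open import Relation.Binary.PropositionalEquality as ≡ using (_≡_)
import Relation.Binary.Reasoning.Setoid as SetoidReasoning
open import Relation.Nullary using (Dec; ¬_; yes; no; does)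
open import Relation.Nullary.Decidable using (does-⇔; dec-true; dec-false)

-- Sequences in a setoid

module _ {a ℓ} (A : Setoid a ℓ) where
  open Setoid A using (_≈_; refl; sym; trans)
  open Membership A using (_∈_)
  open Sublist A using (_⊆_; []; _∷_; _∷ʳ_; to∈; minimum)
  open UniqueSetoid A using (Unique)

  ⊆-++⁻ : ∀ {xs} ys {zs} → xs ⊆ ys ++ zs → ∃₂ λ xs₁ xs₂ → xs ≡ xs₁ ++ xs₂ × xs₁ ⊆ ys × xs₂ ⊆ zs
  ⊆-++⁻ []       sub = [] , _ , ≡.refl , [] , sub
  ⊆-++⁻ (y ∷ ys) (.y ∷ʳ sub) with ⊆-++⁻ ys sub
  ... | xs₁ , xs₂ , eq , sub₁ , sub₂ = xs₁ , xs₂ , eq , y ∷ʳ sub₁ , sub₂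
  ⊆-++⁻ (y ∷ ys) (x≈y ∷ sub) with ⊆-++⁻ ys sub
  ... | xs₁ , xs₂ , ≡.refl , sub₁ , sub₂ = _ ∷ xs₁ , xs₂ , ≡.refl , x≈y ∷ sub₁ , sub₂

  ⊆⇒∈ₛ : ∀ {x xs ys} → xs ⊆ ys → x ∈ xs → x ∈ ys
  ⊆⇒∈ₛ = Sublist.lookup A (λ x≈y z≈x → trans z≈x x≈y)

  Unique-++⁻ʳ : ∀ xs {ys} → Unique (xs ++ ys) → Unique ys
  Unique-++⁻ʳ []       uniq       = uniq
  Unique-++⁻ʳ (x ∷ xs) (_ ∷ uniq) = Unique-++⁻ʳ xs uniq

  Unique-++-disjoint : ∀ {xs ys x} → Unique (xs ++ ys) → x ∈ xs → ¬ x ∈ ys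
  Unique-++-disjoint {x′ ∷ xs} (x∉ ∷ _)  (here x≈)  x∈ys =
    Allₚ.All¬⇒¬Any x∉ (Membershipₚ.∈-resp-≈ A x≈ (Membershipₚ.∈-++⁺ʳ A xs x∈ys))
  Unique-++-disjoint           (_ ∷ uniq) (there x∈) x∈ys = Unique-++-disjoint uniq x∈ x∈ys

  -- The embedding cuts `L` into pieces lying over `P`, `D` and `R`. An entry placed in `P` or `R`
  -- would also occur in `D`, against uniqueness, so those two pieces are empty.
  ⊆-confined : ∀ P {D R L} → Unique (P ++ D ++ R) → L ⊆ P ++ D ++ R → (∀ {x} → x ∈ L → x ∈ D) → L ⊆ D
  ⊆-confined P {D} {R} {L} uniq sub L∈D with ⊆-++⁻ P sub
  ... | x ∷ _ , _ , ≡.refl , sub₁ , _ = ⊥-elim (Unique-++-disjoint uniq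
    (⊆⇒∈ₛ sub₁ (here refl)) (Membershipₚ.∈-++⁺ˡ A (L∈D (here refl))))
  ... | [] , _ , ≡.refl , _ , sub₂ with ⊆-++⁻ D sub₂
  ...   | L₁ , [] , ≡.refl , sub₃ , _ = ≡.subst (_⊆ D) (≡.sym (Listₚ.++-identityʳ L₁)) sub₃
  ...   | L₁ , x ∷ _ , ≡.refl , _ , sub₄ = ⊥-elim (Unique-++-disjoint (Unique-++⁻ʳ P uniq)
    (L∈D (Membershipₚ.∈-++⁺ʳ A L₁ (here refl))) (⊆⇒∈ₛ sub₄ (here refl)))

  -- Two entries of a duplicate-free list occur in only one order. The case `x ≈ y` is included: it
  -- says that no entry occurs twice.
  Unique-pair : ∀ {xs x y} → Unique xs → x ∷ y ∷ [] ⊆ xs → ¬ y ∷ x ∷ [] ⊆ xs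
  Unique-pair (_ ∷ uniq) (_ ∷ʳ p)  (_ ∷ʳ q)  = Unique-pair uniq p q
  Unique-pair (z∉ ∷ _)   (x≈z ∷ _) (_ ∷ʳ q)  = Allₚ.All¬⇒¬Any z∉ (Membershipₚ.∈-resp-≈ A x≈z (to∈ (Sublistₚ.∷ˡ⁻ A q)))
  Unique-pair (z∉ ∷ _)   (x≈z ∷ _) (_ ∷ q)   = Allₚ.All¬⇒¬Any z∉ (Membershipₚ.∈-resp-≈ A x≈z (to∈ q))
  Unique-pair (z∉ ∷ _)   (_ ∷ʳ p)  (y≈z ∷ _) = Allₚ.All¬⇒¬Any z∉ (Membershipₚ.∈-resp-≈ A y≈z (to∈ (Sublistₚ.∷ˡ⁻ A p)))

  Unique-applyUpTo⁻ : ∀ f n {j} → Unique (applyUpTo f n) → suc j < n → ¬ f 0 ≈ f (suc j)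
  Unique-applyUpTo⁻ f (suc n) (f0∉ ∷ _) (s≤s j<n) f0≈ =
    Allₚ.All¬⇒¬Any f0∉ (Membershipₚ.∈-resp-≈ A (sym f0≈) (Membershipₚ.∈-applyUpTo⁺ A (f ∘ suc) j<n))

  applyUpTo-⊆-pair : ∀ f {n} → 1 < n → f 0 ∷ f 1 ∷ [] ⊆ applyUpTo f n
  applyUpTo-⊆-pair f (s≤s (s≤s z≤n)) = refl ∷ refl ∷ minimum _

  open ListEquality A using (_≋_)

  applyUpTo-≋⁻ : ∀ {f g} n → applyUpTo f n ≋ applyUpTo g n → ∀ {i} → i < n → f i ≈ g i
  applyUpTo-≋⁻ (suc n) (eq ∷ _)  {zero}  _         = eq
  applyUpTo-≋⁻ (suc n) (_ ∷ eqs) {suc i} (s≤s i<n) = applyUpTo-≋⁻ n eqs i<n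

  applyDownFrom-≋-applyUpTo : ∀ {f g} n → (∀ i j → suc (i + j) ≡ n → f i ≈ g j) →
    applyDownFrom f n ≋ applyUpTo g n
  applyDownFrom-≋-applyUpTo zero    eq = []
  applyDownFrom-≋-applyUpTo (suc n) eq = eq n 0 (≡.cong suc (ℕₚ.+-identityʳ n)) ∷
    applyDownFrom-≋-applyUpTo n λ i j i+j≡ → eq i (suc j) (≡.cong suc (≡.trans (ℕₚ.+-suc i j) i+j≡))

applyUpTo-adjacent : ∀ {a} {A : Set a} (f : ℕ → A) n xs {x y ys} → applyUpTo f n ≡ xs ++ x ∷ y ∷ ys →
  ∃ λ i → f i ≡ x × f (suc i) ≡ y
applyUpTo-adjacent f (suc (suc n)) []       ≡.refl = 0 , ≡.refl , ≡.refl
applyUpTo-adjacent f (suc n)       (_ ∷ xs) eq with applyUpTo-adjacent (f ∘ suc) n xs (Listₚ.∷-injectiveʳ eq)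
... | i , p , q = suc i , p , q

-- Coefficients of basis elements

module FreeModuleProperties {c ℓ} (X : DecSetoid c ℓ) where
  open FreeModule X
  open DecSetoid X using (_≟_) renaming (_≈_ to _≈ˣ_)

  basis-≈ : ∀ {a x} → x ≈ˣ a → coeff (basis a) x ≡ 1ℤ
  basis-≈ {a} {x} x≈a with x ≟ a
  ... | yes _  = ≡.refl
  ... | no x≉a = ⊥-elim (x≉a x≈a)

  basis-≉ : ∀ {a x} → ¬ x ≈ˣ a → coeff (basis a) x ≡ 0ℤ
  basis-≉ {a} {x} x≉a with x ≟ a
  ... | yes x≈a = ⊥-elim (x≉a x≈a)
  ... | no _    = ≡.refl

module Reflections {ℓ} {S : Set ℓ} (M : CoxeterMatrix S) where
  open CoxeterGroup M
  open Group group using (∙-congˡ; ∙-congʳ; monoid)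
  open GroupProperties group
  open MonoidProperties monoid using (cancelʳ; elimˡ)
  open SetoidReasoning W-setoid

  -- Conjugation and involutions

  conj-congˡ : ∀ {x y} g → x ≈ y → conj x g ≈ conj y g
  conj-congˡ g x≈y = ∙-cong (∙-congʳ x≈y) (⁻¹-cong x≈y)

  conj-by-ε : ∀ g → conj ε g ≈ g
  conj-by-ε g = ≈-trans (∙-cong (identityˡ g) ε⁻¹≈ε) (identityʳ g)

  conj-by-∙ : ∀ x y g → conj (x ∙ y) g ≈ conj x (conj y g)
  conj-by-∙ x y g = begin
    x ∙ y ∙ g ∙ (x ∙ y) ⁻¹      ≈⟨ ∙-cong (assoc x y g) (⁻¹-anti-homo-∙ x y) ⟩
    x ∙ (y ∙ g) ∙ (y ⁻¹ ∙ x ⁻¹) ≈⟨ assoc _ _ _ ⟨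
    x ∙ (y ∙ g) ∙ y ⁻¹ ∙ x ⁻¹   ≈⟨ ∙-congʳ (assoc _ _ _) ⟩
    x ∙ (y ∙ g ∙ y ⁻¹) ∙ x ⁻¹   ∎

  conj-inverseˡ : ∀ x g → conj (x ⁻¹) (conj x g) ≈ g
  conj-inverseˡ x g = ≈-trans (≈-sym (conj-by-∙ _ _ g)) (≈-trans (conj-congˡ g (inverseˡ x)) (conj-by-ε g))

  conj-inverseʳ : ∀ x g → conj x (conj (x ⁻¹) g) ≈ g
  conj-inverseʳ x g = ≈-trans (≈-sym (conj-by-∙ _ _ g)) (≈-trans (conj-congˡ g (inverseʳ x)) (conj-by-ε g))

  conj-injective : ∀ x {g h} → conj x g ≈ conj x h → g ≈ h
  conj-injective x eq = ≈-trans (≈-sym (conj-inverseˡ x _)) (≈-trans (conj-cong (x ⁻¹) eq) (conj-inverseˡ x _))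

  conj-self : ∀ g → conj g g ≈ g
  conj-self g = cancelʳ (inverseʳ g) g

  Involution : W → Set ℓ
  Involution g = g ∙ g ≈ ε

  Involution-conj : ∀ x {g} → Involution g → Involution (conj x g)
  Involution-conj x {g} g² = ≈-trans (conj-∙ x g g) (≈-trans (conj-cong x g²) (conj-ε x))

  Involution-resp : ∀ {g h} → g ≈ h → Involution g → Involution h
  Involution-resp g≈h g² = ≈-trans (∙-cong (≈-sym g≈h) (≈-sym g≈h)) g²

  Involution-⁻¹ : ∀ {g} → Involution g → g ⁻¹ ≈ g
  Involution-⁻¹ g² = ≈-sym (inverseʳ-unique _ _ g²)

  conj-involutive : ∀ {x} → Involution x → ∀ g → conj x (conj x g) ≈ g
  conj-involutive x² g = ≈-trans (≈-sym (conj-by-∙ _ _ g)) (≈-trans (conj-congˡ g x²) (conj-by-ε g))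

  -- Powers and the entries of `ρ`

  ∙-^-slide : ∀ g h i → g ∙ (h ∙ g) ^ i ≈ (g ∙ h) ^ i ∙ g
  ∙-^-slide g h zero    = ≈-trans (identityʳ g) (≈-sym (identityˡ g))
  ∙-^-slide g h (suc i) = begin
    g ∙ (h ∙ g ∙ (h ∙ g) ^ i)   ≈⟨ assoc _ _ _ ⟨
    g ∙ (h ∙ g) ∙ (h ∙ g) ^ i   ≈⟨ ∙-congʳ (assoc _ _ _) ⟨
    g ∙ h ∙ g ∙ (h ∙ g) ^ i     ≈⟨ assoc _ _ _ ⟩
    g ∙ h ∙ (g ∙ (h ∙ g) ^ i)   ≈⟨ ∙-congˡ (∙-^-slide g h i) ⟩
    g ∙ h ∙ ((g ∙ h) ^ i ∙ g)   ≈⟨ assoc _ _ _ ⟨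
    (g ∙ h) ^ suc i ∙ g         ∎

  ^-snoc : ∀ g i → g ^ suc i ≈ g ^ i ∙ g
  ^-snoc g zero    = ≈-trans (identityʳ g) (≈-sym (identityˡ g))
  ^-snoc g (suc i) = ≈-trans (∙-congˡ (^-snoc g i)) (≈-sym (assoc _ _ _))

  ^-+ : ∀ g i j → g ^ (i + j) ≈ g ^ i ∙ g ^ j
  ^-+ g zero    j = ≈-sym (identityˡ _)
  ^-+ g (suc i) j = ≈-trans (∙-congˡ (^-+ g i j)) (≈-sym (assoc _ _ _))

  ^-multiple : ∀ g k → g ^ k ≈ ε → ∀ q → g ^ (q * k) ≈ ε
  ^-multiple g k gᵏ zero    = ≈-refl
  ^-multiple g k gᵏ (suc q) = ≈-trans (^-+ g k (q * k)) (≈-trans (∙-cong gᵏ (^-multiple g k gᵏ q)) (identityˡ ε))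

  -- The alternating product `u v u ⋯ u` with `2i + 1` factors. For `i` below the order of `u v`
  -- these are the entries of `ρ`; larger indices are allowed so that recursion on `i` needs no
  -- bound.
  reflection : W → W → ℕ → W
  reflection u v i = (u ∙ v) ^ i ∙ u

  reflection-zero : ∀ u v → reflection u v 0 ≈ u
  reflection-zero u v = identityˡ u

  conj-reflection-∙ : ∀ q u v i → conj q (reflection u v i) ≈ reflection (conj q u) (conj q v) i
  conj-reflection-∙ q u v i = ≈-sym (begin
    (conj q u ∙ conj q v) ^ i ∙ conj q u ≈⟨ ∙-congʳ (^-cong i (conj-∙ q u v)) ⟩
    conj q (u ∙ v) ^ i ∙ conj q u        ≈⟨ ∙-congʳ (conj-^ q _ i) ⟩
    conj q ((u ∙ v) ^ i) ∙ conj q u      ≈⟨ conj-∙ q _ u ⟩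
    conj q (reflection u v i)                  ∎)

  reflection-ε : ∀ u v i → reflection u v i ≈ u → (u ∙ v) ^ i ≈ ε
  reflection-ε u v i eq = identityˡ-unique _ u eq

  reflection-+ : ∀ u v i j → (u ∙ v) ^ i ≈ ε → reflection u v (i + j) ≈ reflection u v j
  reflection-+ u v i j eq = ∙-congʳ (≈-trans (^-+ _ i j) (elimˡ eq _))

  module _ {u v : W} (u² : Involution u) where

    -- As `u⁻¹ ≈ u`, conjugation by `u` adds a factor `u` at each end of `v u ⋯ v`.
    reflection-suc : ∀ i → conj u (reflection v u i) ≈ reflection u v (suc i)
    reflection-suc i = begin
      u ∙ ((v ∙ u) ^ i ∙ v) ∙ u ⁻¹ ≈⟨ ∙-cong (≈-sym (assoc _ _ _)) (Involution-⁻¹ u²) ⟩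
      u ∙ (v ∙ u) ^ i ∙ v ∙ u      ≈⟨ ∙-congʳ (∙-congʳ (∙-^-slide u v i)) ⟩
      (u ∙ v) ^ i ∙ u ∙ v ∙ u      ≈⟨ ∙-congʳ (assoc _ _ _) ⟩
      (u ∙ v) ^ i ∙ (u ∙ v) ∙ u    ≈⟨ ∙-congʳ (^-snoc _ i) ⟨
      (u ∙ v) ^ suc i ∙ u          ∎

    reflection-pred : ∀ i → conj u (reflection u v (suc i)) ≈ reflection v u i
    reflection-pred i = ≈-trans (conj-cong u (≈-sym (reflection-suc i))) (conj-involutive u² _)

    conj-reflection-zero : conj u (reflection u v 0) ≈ reflection u v 0
    conj-reflection-zero = ≈-trans (conj-cong u (reflection-zero u v)) (≈-trans (conj-self u) (≈-sym (reflection-zero u v)))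

  reflection-involution : ∀ {u v} → Involution u → Involution v → ∀ i → Involution (reflection u v i)
  reflection-involution {v = v} u² v² zero    = Involution-resp (≈-sym (reflection-zero _ v)) u²
  reflection-involution u² v² (suc i) = Involution-resp (reflection-suc u² i) (Involution-conj _ (reflection-involution v² u² i))

  -- The conjugating entry is `u v` times the conjugated one, which commutes with itself. What
  -- remains is conjugation by `v` and then by `u`, and each lengthens the alternating product.
  reflection-next : ∀ {u v} → Involution u → Involution v → ∀ i →
    conj (reflection u v (suc i)) (reflection u v i) ≈ reflection u v (suc (suc i))
  reflection-next {u} {v} u² v² i = begin
    conj (reflection u v (suc i)) (reflection u v i)       ≈⟨ conj-congˡ _ (assoc (u ∙ v) _ u) ⟩
    conj (u ∙ v ∙ reflection u v i) (reflection u v i)     ≈⟨ conj-by-∙ (u ∙ v) _ _ ⟩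
    conj (u ∙ v) (conj (reflection u v i) (reflection u v i)) ≈⟨ conj-cong (u ∙ v) (conj-self _) ⟩
    conj (u ∙ v) (reflection u v i)                  ≈⟨ conj-by-∙ u v _ ⟩
    conj u (conj v (reflection u v i))               ≈⟨ conj-cong u (reflection-suc v² i) ⟩
    conj u (reflection v u (suc i))                  ≈⟨ reflection-suc u² (suc i) ⟩
    reflection u v (suc (suc i))                     ∎

  reflection-previous : ∀ {u v} → Involution u → Involution v → ∀ i →
    conj (reflection u v (suc i)) (reflection u v (suc (suc i))) ≈ reflection u v i
  reflection-previous u² v² i = ≈-trans (conj-cong _ (≈-sym (reflection-next u² v² i)))
    (conj-involutive (reflection-involution u² v² (suc i)) _)

  -- With k the order of u v, the i-th and the j-th entry agree when i + j = k − 1.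
  reflection-flip : ∀ {u v} → Involution u → Involution v → ∀ {k} → (u ∙ v) ^ k ≈ ε →
    ∀ i j → suc (i + j) ≡ k → reflection u v i ≈ reflection v u j
  -- After left multiplication by `(u v)^(j+1)` both sides equal `u`: on the left the exponent
  -- reaches `k`, on the right `(v u)^j` cancels all but one factor `u v`.
  reflection-flip {u} {v} u² v² {k} uvᵏ i j ≡.refl = ∙-cancelˡ ((u ∙ v) ^ suc j) _ _ (begin
    (u ∙ v) ^ suc j ∙ reflection u v i             ≈⟨ assoc _ _ _ ⟨
    (u ∙ v) ^ suc j ∙ (u ∙ v) ^ i ∙ u        ≈⟨ ∙-congʳ (^-+ _ (suc j) i) ⟨
    (u ∙ v) ^ suc (j + i) ∙ u                ≡⟨ ≡.cong (λ n → (u ∙ v) ^ suc n ∙ u) (ℕₚ.+-comm j i) ⟩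
    (u ∙ v) ^ suc (i + j) ∙ u                ≈⟨ elimˡ uvᵏ u ⟩
    u                                        ≈⟨ cancelʳ v² u ⟨
    u ∙ v ∙ v                                ≈⟨ ∙-congʳ (shrink j) ⟨
    (u ∙ v) ^ suc j ∙ (v ∙ u) ^ j ∙ v        ≈⟨ assoc _ _ _ ⟩
    (u ∙ v) ^ suc j ∙ reflection v u j             ∎)
    where
    uvvu : u ∙ v ∙ (v ∙ u) ≈ ε
    uvvu = ≈-trans (≈-sym (assoc _ _ _)) (≈-trans (∙-congʳ (cancelʳ v² u)) u²)
    shrink : ∀ j → (u ∙ v) ^ suc j ∙ (v ∙ u) ^ j ≈ u ∙ v
    shrink zero    = ≈-trans (identityʳ _) (identityʳ _)
    shrink (suc j) = begin
      u ∙ v ∙ (u ∙ v) ^ suc j ∙ (v ∙ u ∙ (v ∙ u) ^ j)     ≈⟨ ∙-congʳ (^-snoc _ (suc j)) ⟩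
      (u ∙ v) ^ suc j ∙ (u ∙ v) ∙ (v ∙ u ∙ (v ∙ u) ^ j)   ≈⟨ assoc _ _ _ ⟩
      (u ∙ v) ^ suc j ∙ (u ∙ v ∙ (v ∙ u ∙ (v ∙ u) ^ j))   ≈⟨ ∙-congˡ (≈-trans (≈-sym (assoc _ _ _)) (elimˡ uvvu _)) ⟩
      (u ∙ v) ^ suc j ∙ (v ∙ u) ^ j                       ≈⟨ shrink j ⟩
      u ∙ v                                               ∎

  -- Orders, and the reflections of a dihedral group

  IsOrder-resp : ∀ {g h k} → g ≈ h → IsOrder g k → IsOrder h k
  IsOrder-resp {k = k} g≈h o = record
    { positive = IsOrder.positive o
    ; power    = ≈-trans (^-cong k (≈-sym g≈h)) (IsOrder.power o)
    ; minimal  = λ {j} 0<j hʲ → IsOrder.minimal o 0<j (≈-trans (^-cong j g≈h) hʲ)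
    }

  IsOrder-conj : ∀ x {g k} → IsOrder g k → IsOrder (conj x g) k
  IsOrder-conj x {g} {k} o = record
    { positive = IsOrder.positive o
    ; power    = ≈-trans (conj-^ x g k) (≈-trans (conj-cong x (IsOrder.power o)) (conj-ε x))
    ; minimal  = λ {j} 0<j eq → IsOrder.minimal o 0<j
        (conj-injective x (≈-trans (≈-sym (conj-^ x g j)) (≈-trans eq (≈-sym (conj-ε x)))))
    }

  IsOrder-conj⁻ : ∀ x {g k} → IsOrder (conj x g) k → IsOrder g k
  IsOrder-conj⁻ x o = IsOrder-resp (conj-inverseˡ x _) (IsOrder-conj (x ⁻¹) o)

  -- Conjugation by `u` turns `v u` into `u v`.
  IsOrder-swap : ∀ {u v k} → IsOrder (u ∙ v) k → IsOrder (v ∙ u) k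
  IsOrder-swap {u} {v} o = IsOrder-conj⁻ u
    (IsOrder-resp (≈-sym (≈-trans (∙-congʳ (≈-sym (assoc u v u))) (cancelʳ (inverseʳ u) (u ∙ v)))) o)

  -- The reflections of the dihedral group generated by involutions u and v.
  Dihedral : W → W → W → Set ℓ
  Dihedral u v g = ∃ λ i → g ≈ reflection u v i ⊎ g ≈ reflection v u i

  module _ {u v : W} where

    Dihedral-swap : ∀ {g} → Dihedral u v g → Dihedral v u g
    Dihedral-swap (i , d) = i , Sum.swap d

    Dihedral-resp : ∀ {g h} → g ≈ h → Dihedral u v g → Dihedral u v h
    Dihedral-resp g≈h (i , inj₁ eq) = i , inj₁ (≈-trans (≈-sym g≈h) eq)
    Dihedral-resp g≈h (i , inj₂ eq) = i , inj₂ (≈-trans (≈-sym g≈h) eq)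

    Dihedral-conj-generator : Involution u → ∀ {g} → Dihedral u v g → Dihedral u v (conj u g)
    Dihedral-conj-generator u² (zero  , inj₁ eq) = zero  , inj₁ (≈-trans (conj-cong u eq) (conj-reflection-zero {v = v} u²))
    Dihedral-conj-generator u² (suc i , inj₁ eq) = i     , inj₂ (≈-trans (conj-cong u eq) (reflection-pred u² i))
    Dihedral-conj-generator u² (i     , inj₂ eq) = suc i , inj₁ (≈-trans (conj-cong u eq) (reflection-suc u² i))

  -- Induction on `i`: the next reflection is `u r u⁻¹` with `r = reflection v u i`, so conjugating
  -- by it amounts to conjugating by `u`, by `r` and again by `u`.
  Dihedral-conj-reflection : ∀ {u v} → Involution u → Involution v → ∀ i {g} →
    Dihedral u v g → Dihedral u v (conj (reflection u v i) g)
  Dihedral-conj-reflection {u} {v} u² v² zero    d = Dihedral-resp (conj-congˡ _ (≈-sym (reflection-zero u v))) (Dihedral-conj-generator u² d)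
  Dihedral-conj-reflection {u} {v} u² v² (suc i) {g} d = Dihedral-resp
    (≈-trans (≈-sym (≈-trans (conj-by-∙ _ _ g) (conj-by-∙ u _ _))) (conj-congˡ g (reflection-suc u² i)))
    (Dihedral-conj-generator u² (Dihedral-swap (Dihedral-conj-reflection v² u² i
      (Dihedral-swap (Dihedral-resp (conj-congˡ g (≈-sym (Involution-⁻¹ u²))) (Dihedral-conj-generator u² d))))))

  Dihedral-conj : ∀ {u v} → Involution u → Involution v → ∀ {h g} →
    Dihedral u v h → Dihedral u v g → Dihedral u v (conj h g)
  Dihedral-conj u² v² (i , inj₁ eq) d = Dihedral-resp (conj-congˡ _ (≈-sym eq)) (Dihedral-conj-reflection u² v² i d)
  Dihedral-conj u² v² (i , inj₂ eq) d = Dihedral-resp (conj-congˡ _ (≈-sym eq))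
    (Dihedral-swap (Dihedral-conj-reflection v² u² i (Dihedral-swap d)))

  module _ {u v : W} (u² : Involution u) (v² : Involution v) {k} (o : IsOrder (u ∙ v) k) where

    reflection-bounded : ∀ i → ∃ λ a → a < k × reflection u v i ≈ reflection u v a
    reflection-bounded i = i % k , m%n<n i k , (begin
      reflection u v i                   ≡⟨ ≡.cong (reflection u v) (≡.trans (m≡m%n+[m/n]*n i k) (ℕₚ.+-comm (i % k) _)) ⟩
      reflection u v (i / k * k + i % k) ≈⟨ reflection-+ u v (i / k * k) _ (^-multiple _ k (IsOrder.power o) (i / k)) ⟩
      reflection u v (i % k)             ∎)
      where instance k≢0 = >-nonZero (IsOrder.positive o)

    reflection-complement : ∀ {a} → a < k → ∃ λ j → suc (a + j) ≡ k × reflection u v a ≈ reflection v u j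
    reflection-complement {a} a<k = k ∸ suc a , eq , reflection-flip u² v² (IsOrder.power o) a _ eq
      where
      eq : suc (a + (k ∸ suc a)) ≡ k
      eq = ℕₚ.m+[n∸m]≡n a<k

  module _ {u v : W} (u² : Involution u) (v² : Involution v) {k} (o : IsOrder (u ∙ v) k) where

    -- Exponents count modulo `k`, and a reflection written from the `v` end is rewritten from the
    -- `u` end. Hence `k` consecutive entries exhaust the reflections of the group.
    Dihedral-bounded : ∀ {g} → Dihedral u v g → ∃ λ a → a < k × g ≈ reflection u v a
    Dihedral-bounded (i , inj₁ eq) with reflection-bounded u² v² o i
    ... | a , a<k , eq′ = a , a<k , ≈-trans eq eq′
    Dihedral-bounded (i , inj₂ eq) with reflection-bounded v² u² (IsOrder-swap o) i
    ... | a , a<k , eq′ with reflection-complement v² u² (IsOrder-swap o) a<k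
    ...   | j , ≡.refl , eq″ = j , s≤s (ℕₚ.m≤n+m j a) , ≈-trans eq (≈-trans eq′ eq″)

    -- The alternating words of a reflection from its two ends have lengths `2a + 1` and `2j + 1`
    -- with `a + j + 1 = k`. The lengths add up to `2k`, so one of them is at most `k`.
    Dihedral-halved : ∀ {g} → Dihedral u v g →
      (∃ λ a → a * 2 < k × g ≈ reflection u v a) ⊎ (∃ λ a → a * 2 < k × g ≈ reflection v u a)
    Dihedral-halved d with Dihedral-bounded d
    ... | a , a<k , eq with a * 2 ℕₚ.<? k
    ...   | yes 2a<k = inj₁ (a , 2a<k , eq)
    ...   | no  2a≮k with reflection-complement u² v² o a<k
    ...     | j , ≡.refl , eq′ = inj₂ (j , 2j<k , ≈-trans eq eq′)
      where
      double : ∀ n → n * 2 ≡ n + n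
      double n = ≡.trans (ℕₚ.*-comm n 2) (≡.cong (n +_) (ℕₚ.+-identityʳ n))
      j<a : j < a
      j<a = ℕₚ.+-cancelˡ-< a j a (≡.subst (a + j <_) (double a) (ℕₚ.≮⇒≥ 2a≮k))
      2j<k : j * 2 < suc (a + j)
      2j<k = s≤s (ℕₚ.≤-trans (ℕₚ.≤-reflexive (double j)) (ℕₚ.+-monoˡ-≤ j (ℕₚ.<⇒≤ j<a)))

  -- Words and inversions

  open Membership W-setoid using (_∈_)
  open UniqueSetoid W-setoid using (Unique)
  open ListEquality W-setoid using (≋-sym; ≋-trans; ≋-reflexive)

  product-++ : ∀ a b → product (a ++ b) ≈ product a ∙ product b
  product-++ []      b = ≈-sym (identityˡ _)
  product-++ (s ∷ a) b = ≈-trans (∙-congˡ (product-++ a b)) (≈-sym (assoc _ _ _))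

  product-reverse : ∀ a → product (reverse a) ≈ product a ⁻¹
  product-reverse []      = ≈-sym ε⁻¹≈ε
  product-reverse (s ∷ a) = begin
    product (reverse (s ∷ a))            ≡⟨ ≡.cong product (Listₚ.unfold-reverse s a) ⟩
    product (reverse a ++ [ s ])         ≈⟨ product-++ (reverse a) [ s ] ⟩
    product (reverse a) ∙ (gen s ∙ ε)    ≈⟨ ∙-cong (product-reverse a) (identityʳ _) ⟩
    product a ⁻¹ ∙ gen s                 ≈⟨ ∙-congˡ (Involution-⁻¹ (gen² s)) ⟨
    product a ⁻¹ ∙ gen s ⁻¹              ≈⟨ ⁻¹-anti-homo-∙ _ _ ⟨
    (gen s ∙ product a) ⁻¹               ∎

  expression : ∀ g → ∃ λ a → product a ≈ g
  expression (gen s) = [ s ] , identityʳ _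
  expression ε       = [] , ≈-refl
  expression (g ∙ h) with expression g | expression h
  ... | a , a≈g | b , b≈h = a ++ b , ≈-trans (product-++ a b) (∙-cong a≈g b≈h)
  expression (g ⁻¹) with expression g
  ... | a , a≈g = reverse a , ≈-trans (product-reverse a) (⁻¹-cong a≈g)

  product-alternating : ∀ s t i → product (alternating s t (suc (i * 2))) ≈ reflection (gen s) (gen t) i
  product-alternating s t zero    = ≈-trans (identityʳ _) (≈-sym (identityˡ _))
  product-alternating s t (suc i) = begin
    gen s ∙ (gen t ∙ product (alternating s t (suc (i * 2)))) ≈⟨ assoc _ _ _ ⟨
    gen s ∙ gen t ∙ product (alternating s t (suc (i * 2)))   ≈⟨ ∙-congˡ (product-alternating s t i) ⟩
    gen s ∙ gen t ∙ reflection (gen s) (gen t) i              ≈⟨ assoc _ _ _ ⟨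
    reflection (gen s) (gen t) (suc i)                        ∎

  -- `Invs` in recursive form, for induction on the word; `Invs≋inversions` identifies the two.
  inversions : Expression → List W
  inversions []      = []
  inversions (s ∷ a) = gen s ∷ map (conj (gen s)) (inversions a)

  Invs≋inversions : ∀ a → Invs a ≋ inversions a
  Invs≋inversions []      = []
  Invs≋inversions (s ∷ a) = conj-by-ε (gen s) ∷ ≋-trans
    (ListEquality.tabulate⁺ W-setoid (λ i → conj-by-∙ (gen s) _ _))
    (≋-trans (≋-reflexive (≡.sym (Listₚ.map-tabulate _ (conj (gen s)))))
      (ListEquality.map⁺ W-setoid W-setoid (conj-cong (gen s)) (Invs≋inversions a)))

  map-conj-conj : ∀ x y gs → map (conj (x ∙ y)) gs ≋ map (conj x) (map (conj y) gs)
  map-conj-conj x y []       = []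
  map-conj-conj x y (g ∷ gs) = conj-by-∙ x y g ∷ map-conj-conj x y gs

  map-conj-congˡ : ∀ {x y} → x ≈ y → ∀ gs → map (conj x) gs ≋ map (conj y) gs
  map-conj-congˡ x≈y []       = []
  map-conj-congˡ x≈y (g ∷ gs) = conj-congˡ g x≈y ∷ map-conj-congˡ x≈y gs

  map-conj-cong : ∀ x {gs hs} → gs ≋ hs → map (conj x) gs ≋ map (conj x) hs
  map-conj-cong x = ListEquality.map⁺ W-setoid W-setoid (conj-cong x)

  inversions-++ : ∀ a b → inversions (a ++ b) ≋ inversions a ++ map (conj (product a)) (inversions b)
  inversions-++ []      b = map-id (inversions b)
    where
    map-id : ∀ gs → gs ≋ map (conj ε) gs
    map-id []       = []
    map-id (g ∷ gs) = ≈-sym (conj-by-ε g) ∷ map-id gs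
  inversions-++ (s ∷ a) b = ≈-refl ∷ ≋-trans (map-conj-cong (gen s) (inversions-++ a b))
    (≋-trans (≋-reflexive (Listₚ.map-++ (conj (gen s)) (inversions a) _))
      (ListEquality.++⁺ˡ W-setoid _ (≋-sym (map-conj-conj (gen s) (product a) (inversions b)))))

  inversions-alternating : ∀ s t n → inversions (alternating s t n) ≋ applyUpTo (reflection (gen s) (gen t)) n
  inversions-alternating s t zero    = []
  inversions-alternating s t (suc n) = ≈-sym (reflection-zero _ (gen t)) ∷ ≋-trans
    (map-conj-cong (gen s) (inversions-alternating t s n))
    (≋-trans (≋-reflexive (Listₚ.map-applyUpTo _ (conj (gen s)) n)) (applyUpTo-cong n (reflection-suc (gen² s))))

  -- Multiplying by the inversion that belongs to a letter cancels this letter from the word.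
  deletion : ∀ a {g} → g ∈ inversions a → ∃ λ c → length c < length a × product c ≈ g ∙ product a
  deletion (s ∷ a) {g} (here g≈s) = a , ℕₚ.≤-refl ,
    ≈-sym (≈-trans (≈-sym (assoc _ _ _)) (elimˡ (≈-trans (∙-congʳ g≈s) (gen² s)) _))
  deletion (s ∷ a) {g} (there g∈) with Membershipₚ.∈-map⁻ W-setoid W-setoid g∈
  ... | h , h∈ , g≈ with deletion a h∈
  ...   | c , c<a , c≈ = s ∷ c , s≤s c<a , (begin
    gen s ∙ product c              ≈⟨ ∙-congˡ c≈ ⟩
    gen s ∙ (h ∙ product a)        ≈⟨ assoc _ _ _ ⟨
    gen s ∙ h ∙ product a          ≈⟨ ∙-congʳ (cancelʳ (inverseˡ (gen s)) _) ⟨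
    conj (gen s) h ∙ gen s ∙ product a ≈⟨ assoc _ _ _ ⟩
    conj (gen s) h ∙ (gen s ∙ product a) ≈⟨ ∙-congʳ g≈ ⟨
    g ∙ (gen s ∙ product a) ∎)

  Reduced : Expression → Set ℓ
  Reduced a = ∀ c → product c ≈ product a → length a ≤ length c

  Reduced-++⁻ˡ : ∀ a b → Reduced (a ++ b) → Reduced a
  Reduced-++⁻ˡ a b red c c≈a = ℕₚ.+-cancelʳ-≤ (length b) _ _
    (≡.subst₂ _≤_ (Listₚ.length-++ a) (Listₚ.length-++ c) (red (c ++ b)
      (≈-trans (product-++ c b) (≈-trans (∙-congʳ c≈a) (≈-sym (product-++ a b))))))

  Reduced-++⁻ʳ : ∀ a b → Reduced (a ++ b) → Reduced b
  Reduced-++⁻ʳ a b red c c≈b = ℕₚ.+-cancelˡ-≤ (length a) _ _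
    (≡.subst₂ _≤_ (Listₚ.length-++ a) (Listₚ.length-++ a) (red (a ++ c)
      (≈-trans (product-++ a c) (≈-trans (∙-congˡ c≈b) (≈-sym (product-++ a b))))))

  -- If `s` recurred among the later inversions, it would be an inversion of `a` itself, and
  -- `deletion` would yield a word for `s a` shorter than `a`.
  inversions-unique : ∀ a → Reduced a → Unique (inversions a)
  inversions-unique []      red = []
  inversions-unique (s ∷ a) red =
    Allₚ.¬Any⇒All¬ _ s∉ ∷ Uniqueₚ.map⁺ W-setoid W-setoid (conj-injective (gen s)) (inversions-unique a (Reduced-++⁻ʳ [ s ] a red))
    where
    s∉ : ¬ gen s ∈ map (conj (gen s)) (inversions a)
    s∉ s∈ with Membershipₚ.∈-map⁻ W-setoid W-setoid s∈
    ... | h , h∈ , s≈ with deletion a h∈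
    ...   | c , c<a , c≈ = ℕₚ.<⇒≱ (ℕₚ.<-trans c<a (ℕₚ.n<1+n _))
      (red c (≈-trans c≈ (∙-congʳ (conj-injective (gen s) (≈-trans (≈-sym s≈) (≈-sym (conj-self (gen s))))))))

  Invs-unique : ∀ a → Reduced a → Unique (Invs a)
  Invs-unique a red = ListEquality.Unique-resp-≋ W-setoid (≋-sym (Invs≋inversions a)) (inversions-unique a red)

  -- The parity cocycle

  xor-sum : (ℕ → Bool) → ℕ → Bool
  xor-sum f zero    = false
  xor-sum f (suc n) = f 0 xor xor-sum (f ∘ suc) n

  xor-sum-cong : ∀ {f g} n → (∀ i → f i ≡ g i) → xor-sum f n ≡ xor-sum g n
  xor-sum-cong zero    f≡g = ≡.refl
  xor-sum-cong (suc n) f≡g = ≡.cong₂ _xor_ (f≡g 0) (xor-sum-cong n (f≡g ∘ suc))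

  xor-sum-+ : ∀ f m n → xor-sum f (m + n) ≡ xor-sum f m xor xor-sum (λ i → f (m + i)) n
  xor-sum-+ f zero    n = ≡.refl
  xor-sum-+ f (suc m) n = ≡.trans (≡.cong (f 0 xor_) (xor-sum-+ (f ∘ suc) m n)) (≡.sym (xor-assoc (f 0) _ _))

  xor-sum-false : ∀ f n → (∀ {i} → i < n → f i ≡ false) → xor-sum f n ≡ false
  xor-sum-false f zero    f≡ = ≡.refl
  xor-sum-false f (suc n) f≡ = ≡.cong₂ _xor_ (f≡ (s≤s z≤n)) (xor-sum-false (f ∘ suc) n (f≡ ∘ s≤s))

  module Parity (em : ExcludedMiddle ℓ) where

    same : W → W → Bool
    same g h = does (em {g ≈ h})

    same-⇔ : ∀ {g h g′ h′} → (g ≈ h → g′ ≈ h′) → (g′ ≈ h′ → g ≈ h) → same g h ≡ same g′ h′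
    same-⇔ to from = does-⇔ (mk⇔ to from) em em

    same-cong : ∀ {g h g′ h′} → g ≈ g′ → h ≈ h′ → same g h ≡ same g′ h′
    same-cong g≈ h≈ = same-⇔ (λ eq → ≈-trans (≈-sym g≈) (≈-trans eq h≈)) (λ eq → ≈-trans g≈ (≈-trans eq (≈-sym h≈)))

    same-true : ∀ {g h} → same g h ≡ true → g ≈ h
    same-true {g} {h} eq with em {g ≈ h}
    ... | yes g≈h = g≈h
    same-true () | no _

    -- For a reflection t and a word a, η (product a) t is the parity of the number of
    -- occurrences of t in Invs a; the recursion is the cocycle rule.
    η : W → W → Bool
    η (gen s) t = same t (gen s)
    η ε       t = false
    η (g ∙ h) t = η g t xor η h (conj (g ⁻¹) t)
    η (g ⁻¹)  t = η g (conj g t)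

    η-congʳ : ∀ g {t t′} → t ≈ t′ → η g t ≡ η g t′
    η-congʳ (gen s) t≈ = same-cong t≈ ≈-refl
    η-congʳ ε       t≈ = ≡.refl
    η-congʳ (g ∙ h) t≈ = ≡.cong₂ _xor_ (η-congʳ g t≈) (η-congʳ h (conj-cong _ t≈))
    η-congʳ (g ⁻¹)  t≈ = η-congʳ g (conj-cong g t≈)

    η-assoc : ∀ g h k t → η (g ∙ h ∙ k) t ≡ η (g ∙ (h ∙ k)) t
    η-assoc g h k t = ≡.trans (xor-assoc (η g t) _ _) (≡.cong (λ b → η g t xor (η h _ xor b))
      (η-congʳ k (≈-trans (conj-congˡ t (⁻¹-anti-homo-∙ g h)) (conj-by-∙ _ _ t))))

    η-alternating : ∀ s t n x →
      η (product (alternating s t n)) x ≡ xor-sum (λ i → same x (reflection (gen s) (gen t) i)) n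
    η-alternating s t zero    x = ≡.refl
    η-alternating s t (suc n) x = ≡.cong₂ _xor_ (same-cong ≈-refl (≈-sym (reflection-zero _ (gen t))))
      (≡.trans (η-alternating t s n _) (xor-sum-cong n λ i → same-⇔
        (λ eq → ≈-trans (≈-sym (conj-inverseʳ _ x)) (≈-trans (conj-cong _ eq) (reflection-suc (gen² s) i)))
        (λ eq → ≈-trans (conj-congˡ x (Involution-⁻¹ (gen² s))) (≈-trans (conj-cong _ eq) (reflection-pred (gen² s) i)))))

    η-^ : ∀ s t n x → η ((gen s ∙ gen t) ^ n) x ≡ η (product (alternating s t (n * 2))) x
    η-^ s t zero    x = ≡.refl
    η-^ s t (suc n) x = ≡.trans (≡.cong (η (gen s ∙ gen t) x xor_) (η-^ s t n _)) (η-assoc (gen s) (gen t) (product (alternating s t (n * 2))) x)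

    -- The word `s t s t ⋯` of length `2n` has `2n` inversions, and since `(s t)^n ≈ ε` the second
    -- half repeats the first. Every element is therefore counted an even number of times.
    η-relation : ∀ s t n → (gen s ∙ gen t) ^ n ≈ ε → ∀ x → η ((gen s ∙ gen t) ^ n) x ≡ false
    η-relation s t n stⁿ x = ≡.trans (η-^ s t n x) (≡.trans (η-alternating s t (n * 2) x)
      (≡.trans (≡.cong (xor-sum f) (≡.trans (ℕₚ.*-comm n 2) (≡.cong (n +_) (ℕₚ.+-identityʳ n))))
      (≡.trans (xor-sum-+ f n n)
      (≡.trans (≡.cong (xor-sum f n xor_) (xor-sum-cong n λ i → same-cong ≈-refl (reflection-+ _ _ n i stⁿ)))
        (xor-same (xor-sum f n))))))
      where
      f : ℕ → Bool
      f i = same x (reflection (gen s) (gen t) i)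

    -- `η` is defined on group terms; this makes it a function on the group. The group axioms follow
    -- from its recursion and the laws of `_xor_`, so the content lies in `η-relation`.
    η-congˡ : ∀ {g h} → g ≈ h → ∀ t → η g t ≡ η h t
    η-congˡ (relation s s′ {n} eq) t = η-relation s s′ n (relation s s′ eq) t
    η-congˡ ≈-refl           t = ≡.refl
    η-congˡ (≈-sym p)        t = ≡.sym (η-congˡ p t)
    η-congˡ (≈-trans p q)    t = ≡.trans (η-congˡ p t) (η-congˡ q t)
    η-congˡ (∙-cong {h = h} p q) t = ≡.cong₂ _xor_ (η-congˡ p t)
      (≡.trans (η-congʳ h (conj-congˡ t (⁻¹-cong p))) (η-congˡ q _))
    η-congˡ (⁻¹-cong {g} p)  t = ≡.trans (η-congʳ g (conj-congˡ t p)) (η-congˡ p _)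
    η-congˡ (assoc g h k)    t = η-assoc g h k t
    η-congˡ (identityˡ g)    t = η-congʳ g (≈-trans (conj-congˡ t ε⁻¹≈ε) (conj-by-ε t))
    η-congˡ (identityʳ g)    t = xor-identityʳ _
    η-congˡ (inverseˡ g)     t = ≡.trans (≡.cong (η g (conj g t) xor_) (η-congʳ g (conj-congˡ t (⁻¹-involutive g))))
      (xor-same (η g (conj g t)))
    η-congˡ (inverseʳ g)     t = ≡.trans (≡.cong (η g t xor_) (η-congʳ g (conj-inverseʳ g t))) (xor-same (η g t))

    -- An odd number of occurrences is at least one.
    η⇒inversion : ∀ a {t} → η (product a) t ≡ true → t ∈ inversions a
    η⇒inversion (s ∷ a) {t} eq with em {t ≈ gen s}
    ... | yes t≈s = here t≈s
    ... | no  _   = there (Membershipₚ.∈-resp-≈ W-setoid (conj-inverseʳ (gen s) t)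
      (Membershipₚ.∈-map⁺ W-setoid W-setoid (conj-cong (gen s)) (η⇒inversion a eq)))

    -- Comparing η (r y) with η (y s′), where r = y s′ y⁻¹, shows that r has only itself as an inversion
    -- in the dihedral group; but a dihedral reflection has s or t among its inversions.
    conjugate-simple : ∀ {s t s′ k y} → IsOrder (gen s ∙ gen t) k →
      (∀ {d} → Dihedral (gen s) (gen t) d → η y d ≡ false) →
      ∀ a → a * 2 < k → conj y (gen s′) ≈ reflection (gen s) (gen t) a → conj y (gen s′) ≈ gen s
    conjugate-simple {s} {t} {s′} {k} {y} o y-minimal a 2a<k r≈ =
      ≈-trans (conj-cong y (≈-sym (same-true same≡true))) (conj-inverseʳ y (gen s))
      where
      s-dihedral : Dihedral (gen s) (gen t) (gen s)
      s-dihedral = 0 , inj₁ (≈-sym (reflection-zero _ (gen t)))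
      r = conj y (gen s′)
      r² : Involution r
      r² = Involution-conj y (gen² s′)
      -- `r` is an alternating word of length `2a + 1`, at most `k`. Its first inversion is `s`; a
      -- later one, at index `i + 1 < k`, equals `s` only if `(s t)^(i+1) ≈ ε`, which the order
      -- forbids.
      ηr : η r (gen s) ≡ true
      ηr = ≡.trans (η-congˡ (≈-trans r≈ (≈-sym (product-alternating s t a))) (gen s))
        (≡.trans (η-alternating s t (suc (a * 2)) (gen s))
          (≡.cong₂ _xor_ (dec-true em (≈-sym (reflection-zero _ (gen t))))
            (xor-sum-false _ (a * 2) λ {i} i<2a → dec-false em λ s≈ →
              ℕₚ.<⇒≱ (ℕₚ.<-≤-trans (s≤s i<2a) 2a<k)
                (IsOrder.minimal o (s≤s z≤n) (reflection-ε _ _ (suc i) (≈-sym s≈))))))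
      ηry : η (r ∙ y) (gen s) ≡ true
      ηry = ≡.cong₂ _xor_ ηr (y-minimal (Dihedral-resp (conj-congˡ _ (≈-sym (Involution-⁻¹ r²)))
        (Dihedral-conj (gen² s) (gen² t) (a , inj₁ r≈) s-dihedral)))
      -- Since `r y ≈ y s′`, the cocycle rule for `y s′` applies as well. Its term `η y s` vanishes
      -- by minimality, so the other term must be true, and that says `y⁻¹ s y ≈ s′`.
      same≡true : same (conj (y ⁻¹) (gen s)) (gen s′) ≡ true
      same≡true = ≡.trans (≡.sym (≡.cong (_xor same (conj (y ⁻¹) (gen s)) (gen s′)) (y-minimal s-dihedral)))
        (≡.trans (η-congˡ (≈-sym (cancelʳ (inverseˡ y) (y ∙ gen s′))) (gen s)) ηry)

    -- If some reflection d of the dihedral group is an inversion of y, then d y is shorter than y.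
    conjugate-order-acc : ∀ {s t s′ t′ k} → IsOrder (gen s ∙ gen t) k → ¬ gen s′ ≈ gen t′ →
      ∀ y → Acc _<_ (length y) →
      Dihedral (gen s) (gen t) (conj (product y) (gen s′)) → Dihedral (gen s) (gen t) (conj (product y) (gen t′)) →
      IsOrder (conj (product y) (gen s′) ∙ conj (product y) (gen t′)) k
    conjugate-order-acc {s} {t} {s′} {t′} {k} o s′≉t′ y (acc rec) ds dt
      with em {∃ λ d → Dihedral (gen s) (gen t) d × η (product y) d ≡ true}
    ... | yes (d , dd , ηd) with deletion y (η⇒inversion y ηd)
    -- `c` represents `d y`, so conjugating by `c` is conjugating by `y` and then by `d`. Both
    -- conjugates stay in the dihedral group, and the order of their product is unchanged.
    ...   | c , c<y , c≈ = IsOrder-conj⁻ d (IsOrder-resp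
      (≈-trans (∙-cong (eq (gen s′)) (eq (gen t′))) (conj-∙ d _ _))
      (conjugate-order-acc o s′≉t′ c (rec c<y) (transfer ds) (transfer dt)))
      where
      eq : ∀ g → conj (product c) g ≈ conj d (conj (product y) g)
      eq g = ≈-trans (conj-congˡ g c≈) (conj-by-∙ d _ g)
      transfer : ∀ {g} → Dihedral (gen s) (gen t) (conj (product y) g) → Dihedral (gen s) (gen t) (conj (product c) g)
      transfer dg = Dihedral-resp (≈-sym (eq _)) (Dihedral-conj (gen² s) (gen² t) dd dg)
    conjugate-order-acc {s} {t} {s′} {t′} {k} o s′≉t′ y (acc rec) ds dt | no ∄d =
      conclude (simple ds) (simple dt)
      where
      y-minimal : ∀ {d} → Dihedral (gen s) (gen t) d → η (product y) d ≡ false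
      y-minimal dd = ¬-not (λ ηd → ∄d (_ , dd , ηd))
      -- The shorter alternating word of the reflection starts with `s` or with `t`; in the second
      -- case `s` and `t` exchange their roles.
      simple : ∀ {x} → Dihedral (gen s) (gen t) (conj (product y) (gen x)) →
        conj (product y) (gen x) ≈ gen s ⊎ conj (product y) (gen x) ≈ gen t
      simple dx with Dihedral-halved (gen² s) (gen² t) o dx
      ... | inj₁ (a , 2a<k , eq) = inj₁ (conjugate-simple o y-minimal a 2a<k eq)
      ... | inj₂ (a , 2a<k , eq) = inj₂ (conjugate-simple (IsOrder-swap o) (y-minimal ∘ Dihedral-swap) a 2a<k eq)
      conclude : let r = conj (product y) (gen s′); r′ = conj (product y) (gen t′) in
        r ≈ gen s ⊎ r ≈ gen t → r′ ≈ gen s ⊎ r′ ≈ gen t → IsOrder (r ∙ r′) k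
      conclude (inj₁ p) (inj₂ q) = IsOrder-resp (≈-sym (∙-cong p q)) o
      conclude (inj₂ p) (inj₁ q) = IsOrder-resp (≈-sym (∙-cong p q)) (IsOrder-swap o)
      conclude (inj₁ p) (inj₁ q) = ⊥-elim (s′≉t′ (conj-injective (product y) (≈-trans p (≈-sym q))))
      conclude (inj₂ p) (inj₂ q) = ⊥-elim (s′≉t′ (conj-injective (product y) (≈-trans p (≈-sym q))))

    -- A dihedral group conjugate to a standard one cannot sit properly inside another standard one.
    conjugate-order : ∀ {s t s′ t′ k} → IsOrder (gen s ∙ gen t) k → ¬ gen s′ ≈ gen t′ → ∀ x →
      Dihedral (gen s) (gen t) (conj x (gen s′)) → Dihedral (gen s) (gen t) (conj x (gen t′)) →
      IsOrder (conj x (gen s′) ∙ conj x (gen t′)) k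
    conjugate-order o s′≉t′ x ds dt with expression x
    ... | y , y≈x = IsOrder-resp (∙-cong (conj-congˡ _ y≈x) (conj-congˡ _ y≈x))
      (conjugate-order-acc o s′≉t′ y (<-wellFounded _)
        (Dihedral-resp (conj-congˡ _ (≈-sym y≈x)) ds) (Dihedral-resp (conj-congˡ _ (≈-sym y≈x)) dt))

  -- Entries of one sequence inside another dihedral group

  Dihedral-conj-∙⁻ : ∀ q {u v g} → Dihedral (conj q u) (conj q v) g → Dihedral u v (conj (q ⁻¹) g)
  Dihedral-conj-∙⁻ q (i , inj₁ eq) = i , inj₁ (≈-trans (conj-cong _ (≈-trans eq (≈-sym (conj-reflection-∙ q _ _ i)))) (conj-inverseˡ q _))
  Dihedral-conj-∙⁻ q (i , inj₂ eq) = i , inj₂ (≈-trans (conj-cong _ (≈-trans eq (≈-sym (conj-reflection-∙ q _ _ i)))) (conj-inverseˡ q _))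

  module _ {u v x y : W} (u² : Involution u) (v² : Involution v) (x² : Involution x) (y² : Involution y) where

    -- Conjugating an entry by the one before it gives the entry two places back, so neighbours can
    -- be moved down to indices 0 and 1. These entries are `x` and `x y x`, and they yield `y`.
    Dihedral-adjacent : ∀ i → Dihedral u v (reflection x y i) → Dihedral u v (reflection x y (suc i)) →
      Dihedral u v x × Dihedral u v y
    Dihedral-adjacent zero d₀ d₁ = dx ,
      Dihedral-resp (≈-trans (reflection-pred x² 0) (reflection-zero y x)) (Dihedral-conj u² v² dx d₁)
      where dx = Dihedral-resp (reflection-zero x y) d₀
    Dihedral-adjacent (suc i) d₁ d₂ =
      Dihedral-adjacent i (Dihedral-resp (reflection-previous x² y² i) (Dihedral-conj u² v² d₁ d₂)) d₁

  Dihedral-reflection : ∀ {u v x y} → Involution u → Involution v → Involution x → Involution y →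
    Dihedral u v x → Dihedral u v y → ∀ i → Dihedral u v (reflection x y i)
  Dihedral-reflection {y = y} u² v² x² y² dx dy zero    = Dihedral-resp (≈-sym (reflection-zero _ y)) dx
  Dihedral-reflection u² v² x² y² dx dy (suc i) =
    Dihedral-resp (reflection-suc x² i) (Dihedral-conj u² v² dx (Dihedral-reflection u² v² y² x² dy dx i))

  u² : (n : 𝔑) → Involution (𝔑.u n)
  u² n with 𝔑.conjugate n
  ... | x , μ , u≈ , _ = Involution-resp (≈-sym u≈) (Involution-conj x (gen² _))

  1<m : (μ : 𝔐) → 1 < 𝔐.mₛₜ μ
  1<m μ with m (𝔐.s μ) (𝔐.t μ) | m-off (𝔐.s≢t μ) | 𝔐.finite μ
    where open CoxeterMatrix M
  ... | _ | AddSupremum.[ 2≤m ] | ≡.refl = 2≤m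

  IsReducedExpressionFor⇒Reduced : ∀ {w a} → IsReducedExpressionFor w a → Reduced a
  IsReducedExpressionFor⇒Reduced red c c≈a =
    IsReducedExpressionFor.shortest red c (≈-trans c≈a (IsReducedExpressionFor.represents red))

  -- Subwords `ρ` and the reversed block

  module HasProperties (em : ExcludedMiddle ℓ) where
    open Classical em
    open Parity em
    open FreeModuleProperties 𝔑-decSetoid
    open Sublist W-setoid using (⊆-trans; ⊆-reflexive; from∈; minimum; []; _∷_)

    module _ (μ : 𝔐) where
      open 𝔐 μ

      ι-order : IsOrder (gen s ∙ gen t) (mᴺ (ι μ))
      ι-order = proj₂ (order-uv (ι μ))

      -- The order of s t in W could a priori be a proper divisor of m s t.
      ι-order≡m : ∀ p r → Reduced (p ++ alternating s t mₛₜ ++ r) → mᴺ (ι μ) ≡ mₛₜ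
      ι-order≡m p r red with ℕₚ.m≤n⇒m<n∨m≡n (IsOrder.minimal ι-order (positive-m μ) (relation s t finite))
      ... | inj₂ eq = eq
      ... | inj₁ k<m = ⊥-elim (absurd (mᴺ (ι μ)) (IsOrder.positive ι-order) k<m (IsOrder.power ι-order))
        where
        -- The alternating factor is itself reduced, so its `mₛₜ` inversions are distinct. If
        -- `(s t)^k ≈ ε` with `0 < k < mₛₜ`, entries 0 and `k` would coincide.
        uniq : Unique (applyUpTo (reflection (gen s) (gen t)) mₛₜ)
        uniq = ListEquality.Unique-resp-≋ W-setoid (inversions-alternating s t mₛₜ)
          (inversions-unique _ (Reduced-++⁻ˡ (alternating s t mₛₜ) r (Reduced-++⁻ʳ p _ red)))
        absurd : ∀ k → 0 < k → k < mₛₜ → ¬ (gen s ∙ gen t) ^ k ≈ ε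
        absurd (suc k) _ k<m eq = Unique-applyUpTo⁻ W-setoid _ mₛₜ uniq k<m (∙-congʳ (≈-sym eq))

    module _ (q : W) (μ : 𝔐) where
      open 𝔐 μ

      block : List W
      block = map (conj q) (ρ (ι μ))

      block≋ : block ≋ applyUpTo (reflection (conj q (gen s)) (conj q (gen t))) (mᴺ (ι μ))
      block≋ = ≋-trans (≋-reflexive (Listₚ.map-applyUpTo _ (conj q) (mᴺ (ι μ))))
        (applyUpTo-cong (mᴺ (ι μ)) (conj-reflection-∙ q (gen s) (gen t)))

      conj𝔐-order : IsOrder (conj q (gen s) ∙ conj q (gen t)) (mᴺ (ι μ))
      conj𝔐-order = IsOrder-resp (≈-sym (conj-∙ q _ _)) (IsOrder-conj q (ι-order μ))

      ρ-conj𝔐 : ρ (conj𝔐 q μ) ≋ block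
      ρ-conj𝔐 rewrite IsOrder-unique ≈-refl (proj₂ (order-uv (conj𝔐 q μ))) conj𝔐-order = ≋-sym block≋

      ∈block⇒Dihedral : ∀ {g} → g ∈ block → Dihedral (conj q (gen s)) (conj q (gen t)) g
      ∈block⇒Dihedral g∈ with Membershipₚ.∈-applyUpTo⁻ W-setoid _ (Membershipₚ.∈-resp-≋ W-setoid block≋ g∈)
      ... | i , _ , eq = i , inj₁ eq

      s²′ = Involution-conj q (gen² s)
      t²′ = Involution-conj q (gen² t)

      Dihedral⇒∈block : ∀ {g} → Dihedral (conj q (gen s)) (conj q (gen t)) g → g ∈ block
      Dihedral⇒∈block d with Dihedral-bounded s²′ t²′ conj𝔐-order d
      ... | i , i<k , eq = Membershipₚ.∈-resp-≋ W-setoid (≋-sym block≋)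
        (Membershipₚ.∈-resp-≈ W-setoid (≈-sym eq) (Membershipₚ.∈-applyUpTo⁺ W-setoid _ i<k))

      -- The first entry gives `u`; the second is `u v u` and gives `v` on conjugation by `u`. The
      -- bound `1 < mᴺ n` provides the second entry.
      ρ≋block⇒≈ᴺ : ∀ n → 1 < mᴺ n → mᴺ n ≡ mᴺ (ι μ) → ρ n ≋ block → n ≈ᴺ conj𝔐 q μ
      ρ≋block⇒≈ᴺ n 1<k k≡ ρ≋ = u≈ , (begin
        v                               ≈⟨ reflection-zero v u ⟨
        reflection v u 0                ≈⟨ reflection-pred (u² n) 0 ⟨
        conj u (reflection u v 1)       ≈⟨ conj-cong u (entry 1<k) ⟩
        conj u (reflection s′ t′ 1)     ≈⟨ conj-congˡ _ u≈ ⟩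
        conj s′ (reflection s′ t′ 1)    ≈⟨ reflection-pred s²′ 0 ⟩
        reflection t′ s′ 0              ≈⟨ reflection-zero t′ s′ ⟩
        t′                              ∎)
        where
        open 𝔑 n
        s′ = conj q (gen s)
        t′ = conj q (gen t)
        entry : ∀ {i} → i < mᴺ n → reflection u v i ≈ reflection s′ t′ i
        entry = applyUpTo-≋⁻ W-setoid (mᴺ n)
          (≋-trans ρ≋ (≡.subst (λ k → block ≋ applyUpTo (reflection s′ t′) k) (≡.sym k≡) block≋))
        u≈ : u ≈ s′
        u≈ = ≈-trans (≈-sym (reflection-zero u v)) (≈-trans (entry (ℕₚ.<-trans (s≤s z≤n) 1<k)) (reflection-zero s′ t′))

      adjacent-in-block : ∀ n i → let open 𝔑 n in
        reflection u v i ∈ block → reflection u v (suc i) ∈ block → ¬ reflection u v i ≈ reflection u v (suc i) →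
        mᴺ n ≡ mᴺ (ι μ) × (∀ {g} → g ∈ ρ n → g ∈ block)
      adjacent-in-block n i c∈ c′∈ c≉c′ = IsOrder-unique ≈-refl (proj₂ (order-uv n)) order , ρ∈
        where
        open 𝔑 n
        x  = proj₁ conjugate
        μ′ = proj₁ (proj₂ conjugate)
        u≈ : u ≈ conj x (gen (𝔐.s μ′))
        u≈ = proj₁ (proj₂ (proj₂ conjugate))
        v≈ : v ≈ conj x (gen (𝔐.t μ′))
        v≈ = proj₂ (proj₂ (proj₂ conjugate))
        du×dv : Dihedral (conj q (gen s)) (conj q (gen t)) u × Dihedral (conj q (gen s)) (conj q (gen t)) v
        du×dv = Dihedral-adjacent s²′ t²′ (u² n) (v² n) i (∈block⇒Dihedral c∈) (∈block⇒Dihedral c′∈)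
        -- Different elements of `S` might a priori have the same image in `W`. Here that would make
        -- `u v` trivial and all entries of `ρ n` equal, against `c≉c′`.
        distinct : ¬ gen (𝔐.s μ′) ≈ gen (𝔐.t μ′)
        distinct eq = c≉c′ (≈-sym (≈-trans (assoc _ _ _) (elimˡ
          (≈-trans (∙-congʳ (≈-trans u≈ (≈-trans (conj-cong x eq) (≈-sym v≈)))) (v² n)) _)))
        back : ∀ {g h} → g ≈ conj x h → conj (q ⁻¹) g ≈ conj (q ⁻¹ ∙ x) h
        back g≈ = ≈-trans (conj-cong (q ⁻¹) g≈) (≈-sym (conj-by-∙ _ x _))
        order : IsOrder (u ∙ v) (mᴺ (ι μ))
        -- Moved back by `q⁻¹`, the pair becomes a conjugate by `q⁻¹ x` of two simple reflections
        -- and lies in the standard group `⟨s,t⟩`, as `conjugate-order` requires.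
        order = IsOrder-conj⁻ (q ⁻¹) (IsOrder-resp
          (≈-trans (≈-sym (∙-cong (back u≈) (back v≈))) (conj-∙ _ u v))
          (conjugate-order (ι-order μ) distinct (q ⁻¹ ∙ x)
            (Dihedral-resp (back u≈) (Dihedral-conj-∙⁻ q (proj₁ du×dv)))
            (Dihedral-resp (back v≈) (Dihedral-conj-∙⁻ q (proj₂ du×dv)))))
        ρ∈ : ∀ {g} → g ∈ ρ n → g ∈ block
        ρ∈ g∈ with Membershipₚ.∈-applyUpTo⁻ W-setoid _ g∈
        ... | j , _ , eq = Dihedral⇒∈block (Dihedral-resp (≈-sym eq)
          (Dihedral-reflection s²′ t²′ (u² n) (v² n) (proj₁ du×dv) (proj₂ du×dv) j))

      reverse-block : ∀ {n} P R → Unique (P ++ block ++ R) → 1 < mᴺ (ι μ) → ¬ n ≈ᴺ conj𝔐 q μ →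
        ρ n ⊆ P ++ block ++ R → ρ n ⊆ P ++ reverse block ++ R
      reverse-block {n} P R uniq 1<k n≉ sub with ⊆-++⁻ W-setoid P sub
      ... | L₁ , L₂₃ , eq , sub₁ , sub₂₃ with ⊆-++⁻ W-setoid block sub₂₃
      ...   | L₂ , L₃ , ≡.refl , sub₂ , sub₃ = finish L₂ eq sub₂
        where
        open 𝔑 n
        append : ∀ L → ρ n ≡ L₁ ++ L ++ L₃ → L ⊆ reverse block → ρ n ⊆ P ++ reverse block ++ R
        append L eq sub = ≡.subst (_⊆ P ++ reverse block ++ R) (≡.sym eq)
          (Sublistₚ.++⁺ W-setoid sub₁ (Sublistₚ.++⁺ W-setoid sub sub₃))
        finish : ∀ L → ρ n ≡ L₁ ++ L ++ L₃ → L ⊆ block → ρ n ⊆ P ++ reverse block ++ R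
        finish []          eq _   = append [] eq (minimum _)
        finish (x ∷ [])    eq sub = append (x ∷ []) eq
          (from∈ (Membershipₚ.reverse⁺ W-setoid (Sublist.to∈ W-setoid sub)))
        -- The part of `ρ n` over `block` is contiguous, so `x` and `y` are neighbours in `ρ n`.
        -- Then all of `ρ n` lies in `block`; having the same length it equals `block`, and `n` is
        -- the excluded pair.
        finish (x ∷ y ∷ L) eq sub with applyUpTo-adjacent (reflection u v) (mᴺ n) L₁ eq
        ... | i , ≡.refl , ≡.refl = ⊥-elim (n≉ (ρ≋block⇒≈ᴺ n (≡.subst (1 <_) (≡.sym k≡) 1<k) k≡
          (Sublistₚ.to-≋ W-setoid lengths (⊆-confined W-setoid P uniq ⊆PDR ρ∈))))
          where
          ⊆PDR : ρ n ⊆ P ++ block ++ R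
          ⊆PDR = ≡.subst (_⊆ P ++ block ++ R) (≡.sym eq)
            (Sublistₚ.++⁺ W-setoid sub₁ (Sublistₚ.++⁺ W-setoid sub sub₃))
          pair⊆ : ∀ {x y L′} → x ∷ y ∷ L′ ⊆ block → x ∷ y ∷ [] ⊆ P ++ block ++ R
          pair⊆ sub = Sublistₚ.++⁺ˡ W-setoid P (Sublistₚ.++⁺ʳ W-setoid R (⊆-trans (≈-refl ∷ ≈-refl ∷ minimum _) sub))
          c≉c′ : ¬ reflection u v i ≈ reflection u v (suc i)
          c≉c′ c≈c′ = Unique-pair W-setoid uniq (pair⊆ sub)
            (⊆-trans (⊆-reflexive (≈-sym c≈c′ ∷ c≈c′ ∷ [])) (pair⊆ sub))
          all = adjacent-in-block n i (⊆⇒∈ sub (here ≈-refl)) (⊆⇒∈ sub (there (here ≈-refl))) c≉c′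
          k≡ = proj₁ all
          ρ∈ : ∀ {g} → g ∈ ρ n → g ∈ block
          ρ∈ = proj₂ all
          lengths : length (ρ n) ≡ length block
          lengths = ≡.trans (Listₚ.length-applyUpTo _ (mᴺ n)) (≡.trans k≡
            (≡.sym (≡.trans (Listₚ.length-map (conj q) (ρ (ι μ))) (Listₚ.length-applyUpTo _ (mᴺ (ι μ))))))

    -- Reversal as the exchange of `s` and `t`

    mᴺ-swap : ∀ μ → mᴺ (ι (swap μ)) ≡ mᴺ (ι μ)
    mᴺ-swap μ = IsOrder-unique ≈-refl (ι-order (swap μ)) (IsOrder-swap (ι-order μ))

    reverse-ρ : ∀ μ → reverse (ρ (ι μ)) ≋ ρ (ι (swap μ))
    reverse-ρ μ rewrite mᴺ-swap μ = ≋-trans (≋-reflexive (Listₚ.reverse-applyUpTo _ (mᴺ (ι μ))))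
      (applyDownFrom-≋-applyUpTo W-setoid (mᴺ (ι μ))
        (reflection-flip (gen² _) (gen² _) (IsOrder.power (ι-order μ))))

    reverse-block≋ : ∀ q μ → reverse (block q μ) ≋ block q (swap μ)
    reverse-block≋ q μ = ≋-trans (≋-reflexive (≡.sym (Listₚ.reverse-map (conj q) (ρ (ι μ)))))
      (map-conj-cong q (reverse-ρ μ))

    -- This symmetry lets each claim about passing from `a` to `b` serve for the way back, with
    -- `(t′ , s′)` in place of `(s′ , t′)`.
    ReversesFactor-swap : ∀ {q μ a b} → ReversesFactor q μ a b → ReversesFactor q (swap μ) b a
    ReversesFactor-swap {q} {μ} (P , R , a≋ , b≋) = P , R ,
      ≋-trans b≋ (middle (reverse-block≋ q μ)) ,
      ≋-trans a≋ (middle (≋-trans (≋-reflexive (≡.sym (Listₚ.reverse-involutive (block q μ))))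
        (ListEquality.reverse⁺ W-setoid (reverse-block≋ q μ))))
      where
      middle : ∀ {xs ys} → xs ≋ ys → P ++ xs ++ R ≋ P ++ ys ++ R
      middle eq = ListEquality.++⁺ˡ W-setoid P (ListEquality.++⁺ʳ W-setoid R eq)

    ρ-transfer : ∀ {q μ a b n} → ReversesFactor q μ a b → Reduced a → 1 < mᴺ (ι μ) → ¬ n ≈ᴺ conj𝔐 q μ → ρ n ⊆ Invs a → ρ n ⊆ Invs b
    ρ-transfer {q} {μ} {a} {b} {n} (P , R , a≋ , b≋) red 1<k n≉ sub = ⊆-trans
      (reverse-block q μ {n} P R (ListEquality.Unique-resp-≋ W-setoid a≋ (Invs-unique a red)) 1<k n≉
        (⊆-trans sub (⊆-reflexive a≋)))
      (⊆-reflexive (≋-sym b≋))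

    ρ-before : ∀ {q μ a b n} → ReversesFactor q μ a b → n ≈ᴺ conj𝔐 q μ → ρ n ⊆ Invs a
    ρ-before {q} {μ} {a} {b} {n} (P , R , a≋ , _) n≈ = ⊆-trans (⊆-reflexive (≋-trans (ρ-cong {n} {conj𝔐 q μ} n≈) (ρ-conj𝔐 q μ)))
      (⊆-trans (Sublistₚ.++⁺ˡ W-setoid P (Sublistₚ.++⁺ʳ W-setoid R (Sublist.⊆-refl W-setoid))) (⊆-reflexive (≋-sym a≋)))

    -- The reversed factor of `Invs b` has the first two entries of `block` in the opposite order.
    -- If `ρ n` were also a subword, `Invs b` would contain them in both orders.
    ρ-after : ∀ {q μ a b n} → ReversesFactor q μ a b → Reduced b → 1 < mᴺ (ι μ) → n ≈ᴺ conj𝔐 q μ → ¬ ρ n ⊆ Invs b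
    ρ-after {q} {μ} {a} {b} {n} (P , R , _ , b≋) red 1<k n≈ sub = Unique-pair W-setoid (Invs-unique b red)
      (⊆-trans pair⊆ (⊆-trans (⊆-reflexive (≋-sym (≋-trans (ρ-cong {n} {conj𝔐 q μ} n≈) (ρ-conj𝔐 q μ)))) sub))
      (⊆-trans (Sublistₚ.reverse⁺ W-setoid pair⊆)
        (⊆-trans (Sublistₚ.++⁺ˡ W-setoid P (Sublistₚ.++⁺ʳ W-setoid R (Sublist.⊆-refl W-setoid))) (⊆-reflexive (≋-sym b≋))))
      where
      pair⊆ = ⊆-trans (applyUpTo-⊆-pair W-setoid _ 1<k) (⊆-reflexive (≋-sym (block≋ q μ)))

    -- Coefficients of `Has`

    has-yes : ∀ {n a} → ρ n ⊆ Invs a → has n a ≡ 1ℤ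
    has-yes {n} {a} sub with em {ρ n ⊆ Invs a}
    ... | yes _   = ≡.refl
    ... | no ¬sub = ⊥-elim (¬sub sub)

    has-no : ∀ {n a} → ¬ ρ n ⊆ Invs a → has n a ≡ 0ℤ
    has-no {n} {a} ¬sub with em {ρ n ⊆ Invs a}
    ... | yes sub = ⊥-elim (¬sub sub)
    ... | no _    = ≡.refl

    has-⇔ : ∀ {n a b} → (ρ n ⊆ Invs a → ρ n ⊆ Invs b) → (ρ n ⊆ Invs b → ρ n ⊆ Invs a) → has n b ≡ has n a
    has-⇔ {n} {a} {b} to from with em {ρ n ⊆ Invs a}
    ... | yes sub = has-yes {n} {b} (to sub)
    ... | no ¬sub = has-no {n} {b} (¬sub ∘ from)

    -- Equality would give `s ≈ t` in `W`, so that `s t` would have order 1.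
    conj𝔐-swap-≉ : ∀ q μ → 1 < mᴺ (ι μ) → ¬ conj𝔐 q μ ≈ᴺ conj𝔐 q (swap μ)
    conj𝔐-swap-≉ q μ 1<k (s≈t , _) = ℕₚ.<⇒≱ 1<k (IsOrder.minimal (ι-order μ) (s≤s z≤n)
      (≈-trans (identityʳ _) (≈-trans (∙-congʳ (conj-injective q s≈t)) (gen² _))))

    Has-reversal : ∀ {q μ a b} → Reduced a → Reduced b → 1 < mᴺ (ι μ) → ReversesFactor q μ a b →
      Has b ≐ Has a ⊖ basis (conj𝔐 q μ) ⊕ basis (conj𝔐 q (swap μ))
    Has-reversal {q} {μ} {a} {b} ra rb 1<k rev n = cases em em
      where
      rev′ : ReversesFactor q (swap μ) b a
      rev′ = ReversesFactor-swap {q} {μ} {a} {b} rev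
      1<k′ : 1 < mᴺ (ι (swap μ))
      1<k′ = ≡.subst (1 <_) (≡.sym (mᴺ-swap μ)) 1<k
      combine : ∀ {hb ha x y} → has n b ≡ hb → has n a ≡ ha →
        coeff (basis (conj𝔐 q μ)) n ≡ x → coeff (basis (conj𝔐 q (swap μ))) n ≡ y → hb ≡ ha ℤ.- x ℤ.+ y →
        coeff (Has b) n ≡ coeff (Has a ⊖ basis (conj𝔐 q μ) ⊕ basis (conj𝔐 q (swap μ))) n
      combine b≡ a≡ x≡ y≡ eq = ≡.trans b≡ (≡.trans eq (≡.sym (≡.cong₂ ℤ._+_ (≡.cong₂ ℤ._-_ a≡ x≡) y≡)))
      cases : Dec (n ≈ᴺ conj𝔐 q μ) → Dec (n ≈ᴺ conj𝔐 q (swap μ)) →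
        coeff (Has b) n ≡ coeff (Has a ⊖ basis (conj𝔐 q μ) ⊕ basis (conj𝔐 q (swap μ))) n
      cases (yes (p , p′)) (yes (r , r′)) =
        ⊥-elim (conj𝔐-swap-≉ q μ 1<k (≈-trans (≈-sym p) r , ≈-trans (≈-sym p′) r′))
      cases (yes n≈) (no n≉′) = combine
        (has-no {n} {b} (ρ-after {q} {μ} {a} {b} {n} rev rb 1<k n≈)) (has-yes {n} {a} (ρ-before {q} {μ} {a} {b} {n} rev n≈))
        (basis-≈ {conj𝔐 q μ} {n} n≈) (basis-≉ {conj𝔐 q (swap μ)} {n} n≉′) ≡.refl
      cases (no n≉) (yes n≈′) = combine
        (has-yes {n} {b} (ρ-before {q} {swap μ} {b} {a} {n} rev′ n≈′)) (has-no {n} {a} (ρ-after {q} {swap μ} {b} {a} {n} rev′ ra 1<k′ n≈′))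
        (basis-≉ {conj𝔐 q μ} {n} n≉) (basis-≈ {conj𝔐 q (swap μ)} {n} n≈′) ≡.refl
      cases (no n≉) (no n≉′) = combine
        (has-⇔ {n} {a} {b} (ρ-transfer {q} {μ} {a} {b} {n} rev ra 1<k n≉) (ρ-transfer {q} {swap μ} {b} {a} {n} rev′ rb 1<k′ n≉′)) ≡.refl
        (basis-≉ {conj𝔐 q μ} {n} n≉) (basis-≉ {conj𝔐 q (swap μ)} {n} n≉′)
        (≡.sym (≡.trans (ℤₚ.+-identityʳ _) (ℤₚ.+-identityʳ _)))

    -- The factor reversed by a braid move

    Invs-block : ∀ μ p r → mᴺ (ι μ) ≡ 𝔐.mₛₜ μ → let open 𝔐 μ; x = alternating s t mₛₜ in
      Invs (p ++ x ++ r) ≋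
        inversions p ++ block (product p) μ ++ map (conj (product p)) (map (conj (product x)) (inversions r))
    Invs-block μ p r k≡m = ≋-trans (Invs≋inversions _) (≋-trans (inversions-++ p _)
      (ListEquality.++⁺ˡ W-setoid (inversions p) (≋-trans
        (map-conj-cong (product p) (≋-trans (inversions-++ x r)
          (ListEquality.++⁺ʳ W-setoid _ (≋-trans (inversions-alternating s t mₛₜ)
            (≋-reflexive (≡.cong (applyUpTo (reflection (gen s) (gen t))) (≡.sym k≡m)))))))
        (≋-reflexive (Listₚ.map-++ (conj (product p)) (ρ (ι μ)) _)))))
      where
      open 𝔐 μ
      x = alternating s t mₛₜ

    -- The conjugating element is the product of the prefix `p`. As `s t` has order `mₛₜ`, the
    -- inversions of the alternating factor form the full `ρ`, and exchanging `s` and `t` reverses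
    -- it.
    braid⇒ReversesFactor : ∀ μ p r → mᴺ (ι μ) ≡ 𝔐.mₛₜ μ → let open 𝔐 μ in
      product (p ++ alternating s t mₛₜ ++ r) ≈ product (p ++ alternating t s mₛₜ ++ r) →
      ReversesFactor (product p) μ (p ++ alternating s t mₛₜ ++ r) (p ++ alternating t s mₛₜ ++ r)
    braid⇒ReversesFactor μ p r k≡m eq = inversions p , _ , Invs-block μ p r k≡m ,
      ≋-trans (Invs-block (swap μ) p r (≡.trans (mᴺ-swap μ) k≡m))
        (ListEquality.++⁺ˡ W-setoid (inversions p) (ListEquality.++⁺ W-setoid
          (≋-sym (reverse-block≋ (product p) μ))
          (map-conj-cong (product p) (map-conj-congˡ (≈-sym x≈y) (inversions r)))))
      where
      open 𝔐 μ
      x = alternating s t mₛₜ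
      y = alternating t s mₛₜ
      -- Cancelling `p` and `r` from the equal products shows that both alternating factors
      -- conjugate the inversions of `r` in the same way, so the tails agree.
      x≈y : product x ≈ product y
      x≈y = ∙-cancelʳ (product r) _ _ (≈-trans (≈-sym (product-++ x r)) (≈-trans
        (∙-cancelˡ (product p) _ _ (≈-trans (≈-sym (product-++ p _)) (≈-trans eq (product-++ p _))))
        (product-++ y r)))

theorem4p2 : ∀ {ℓ} (em : ExcludedMiddle ℓ) {S : Set ℓ} (M : CoxeterMatrix S) →
    let open CoxeterGroup M
        open Classical em
    in
    (w : W) (μ : 𝔐) (a b : Expression) →
    IsReducedExpressionFor w a → IsReducedExpressionFor w b →
    BraidMove μ a b →
    (∃ λ q → ReversesFactor q μ a b) ×
    (∀ q → ReversesFactor q μ a b →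
      Has b ≐ Has a ⊖ basis (conj𝔐 q μ) ⊕ basis (conj𝔐 q (swap μ)))
theorem4p2 em M w μ a b ra rb (p , r , ≡.refl , ≡.refl) =
  (product p , braid⇒ReversesFactor μ p r k≡m (≈-trans (represents ra) (≈-sym (represents rb)))) ,
  λ q → Has-reversal {q} {μ} {a} {b} (IsReducedExpressionFor⇒Reduced ra) (IsReducedExpressionFor⇒Reduced rb)
    (≡.subst (1 <_) (≡.sym k≡m) (1<m μ))
  where
  open CoxeterGroup M
  open IsReducedExpressionFor
  open Reflections M
  open HasProperties em
  -- Reducedness of `a` forces the order of `s t` in `W` to be exactly `mₛₜ`, which exceeds 1.
  k≡m = ι-order≡m μ p r (IsReducedExpressionFor⇒Reduced ra)
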